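{- For $n\in\mathbb{N}$, $\mathcal{F}_n = n\log 2+O\left(\sqrt{n}\right)$, and hence $\lim_{n\to\infty}\frac{1}{n}\mathcal{F}_n=\log 2$.
   Context: $\mathbb{N}$ denotes the set of positive integers, $\lfloor\cdot\rfloor$ the floor function, and $\log$ the natural logarithm. For $n\in\mathbb{N}$, $\mathcal{F}_n = \#\{k\in\mathbb{Z} : 1\le k\le n,\ \lfloor n/k\rfloor\text{ is odd}\}$. Big O notation: $f(n)=O(g(n))$ means there exist constants $M$ and $a$ such that $|f(n)|\le M g(n)$ for all $n\ge a$. -}

module Defs where

open import Algebra.Definitions.RawMonoid using (sum)
open import Data.Fin.Base using (toℕ)
open import Data.Integer.Base as ℤ using (ℤ; +_)
import Data.Integer.Properties as ℤₚ
open import Data.List.Base using (length; filter; upTo)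
open import Data.Nat.Base as ℕ using (ℕ; zero; suc; NonZero)
import Data.Nat.Properties as ℕₚ
import Data.Nat.Solver as ℕ-Solver
open import Data.Product.Base using (Σ-syntax; ∃-syntax; _×_; _,_; proj₁; proj₂)
open import Data.Rational.Base as ℚ using (ℚ; 0ℚ; 1ℚ; ½; toℚᵘ; fromℚᵘ)
import Data.Rational.Properties as ℚₚ
import Data.Rational.Solver as ℚ-Solver
open import Data.Rational.Unnormalised.Base as ℚᵘ using (ℚᵘ; mkℚᵘ)
import Data.Rational.Unnormalised.Properties as ℚᵘₚ
open import Data.Sum.Base using (inj₁; inj₂)
open import Relation.Binary.PropositionalEquality
open import Relation.Nullary using (yes; no; contradiction)

------------------------------------------------------------------------
-- 𝓕 n = #{ k : 1 ≤ k ≤ n, ⌊n/k⌋ odd }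

-- The list index j stands for k = j + 1; division of naturals is ⌊_/_⌋.
𝓕 : ℕ → ℕ
𝓕 n = length (filter (λ j → (n ℕ./ suc j) ℕ.% 2 ℕₚ.≟ 1) (upTo n))

------------------------------------------------------------------------
-- Arithmetic of ℚ

module ℚ-Lemmas where

  open import Data.Rational.Base hiding (NonZero; ℚ; 0ℚ; 1ℚ; ½; toℚᵘ; fromℚᵘ)
  open ℚ-Solver.+-*-Solver

  fromℚᵘ-homo-+ : ∀ p q → fromℚᵘ (p ℚᵘ.+ q) ≡ fromℚᵘ p + fromℚᵘ q
  fromℚᵘ-homo-+ p q = ℚₚ.toℚᵘ-injective (begin
    toℚᵘ (fromℚᵘ (p ℚᵘ.+ q))                  ≈⟨ ℚₚ.toℚᵘ-fromℚᵘ (p ℚᵘ.+ q) ⟩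
    p ℚᵘ.+ q                                  ≈⟨ ℚᵘₚ.+-cong (ℚₚ.toℚᵘ-fromℚᵘ p) (ℚₚ.toℚᵘ-fromℚᵘ q) ⟨
    toℚᵘ (fromℚᵘ p) ℚᵘ.+ toℚᵘ (fromℚᵘ q)      ≈⟨ ℚₚ.toℚᵘ-homo-+ (fromℚᵘ p) (fromℚᵘ q) ⟨
    toℚᵘ (fromℚᵘ p + fromℚᵘ q)                ∎)
    where open ℚᵘₚ.≃-Reasoning

  fromℚᵘ-homo-* : ∀ p q → fromℚᵘ (p ℚᵘ.* q) ≡ fromℚᵘ p * fromℚᵘ q
  fromℚᵘ-homo-* p q = ℚₚ.toℚᵘ-injective (begin
    toℚᵘ (fromℚᵘ (p ℚᵘ.* q))                  ≈⟨ ℚₚ.toℚᵘ-fromℚᵘ (p ℚᵘ.* q) ⟩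
    p ℚᵘ.* q                                  ≈⟨ ℚᵘₚ.*-cong (ℚₚ.toℚᵘ-fromℚᵘ p) (ℚₚ.toℚᵘ-fromℚᵘ q) ⟨
    toℚᵘ (fromℚᵘ p) ℚᵘ.* toℚᵘ (fromℚᵘ q)      ≈⟨ ℚₚ.toℚᵘ-homo-* (fromℚᵘ p) (fromℚᵘ q) ⟨
    toℚᵘ (fromℚᵘ p * fromℚᵘ q)                ∎)
    where open ℚᵘₚ.≃-Reasoning

  ι : ℕ → ℚ
  ι n = + n / 1

  ι-+ : ∀ m n → ι (m ℕ.+ n) ≡ ι m + ι n
  ι-+ m n = trans
    (ℚₚ.fromℚᵘ-cong {mkℚᵘ (+ (m ℕ.+ n)) 0} {mkℚᵘ (+ m) 0 ℚᵘ.+ mkℚᵘ (+ n) 0}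
      (ℚᵘ.*≡* (cong (ℤ._* + 1) (sym (cong₂ ℤ._+_ (ℤₚ.*-identityʳ (+ m)) (ℤₚ.*-identityʳ (+ n)))))))
    (fromℚᵘ-homo-+ (mkℚᵘ (+ m) 0) (mkℚᵘ (+ n) 0))

  ι-* : ∀ m n → ι (m ℕ.* n) ≡ ι m * ι n
  ι-* m n = trans
    (ℚₚ.fromℚᵘ-cong {mkℚᵘ (+ (m ℕ.* n)) 0} {mkℚᵘ (+ m) 0 ℚᵘ.* mkℚᵘ (+ n) 0}
      (ℚᵘ.*≡* (cong (ℤ._* + 1) (ℤₚ.pos-* m n))))
    (fromℚᵘ-homo-* (mkℚᵘ (+ m) 0) (mkℚᵘ (+ n) 0))

  ι-mono-≤ : ∀ {m n} → m ℕ.≤ n → ι m ≤ ι n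
  ι-mono-≤ {m} {n} m≤n = ℚₚ.toℚᵘ-cancel-≤
    (ℚᵘₚ.≤-respˡ-≃ (ℚᵘₚ.≃-sym (ℚₚ.toℚᵘ-fromℚᵘ (mkℚᵘ (+ m) 0)))
    (ℚᵘₚ.≤-respʳ-≃ (ℚᵘₚ.≃-sym (ℚₚ.toℚᵘ-fromℚᵘ (mkℚᵘ (+ n) 0)))
      (ℚᵘ.*≤* (ℤₚ.*-monoʳ-≤-nonNeg (+ 1) (ℤ.+≤+ m≤n)))))

  0≤ι : ∀ n → 0ℚ ≤ ι n
  0≤ι n = ι-mono-≤ {0} {n} ℕ.z≤n

  archimedean : ∀ q → ∃[ N ] q < ι N
  archimedean q@(mkℚ n d _) = suc ℤ.∣ n ∣ , ℚₚ.toℚᵘ-cancel-<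
    (ℚᵘₚ.<-respʳ-≃ (ℚᵘₚ.≃-sym (ℚₚ.toℚᵘ-fromℚᵘ (mkℚᵘ (+ suc ℤ.∣ n ∣) 0)))
      (ℚᵘ.*<* (ℤₚ.≤-<-trans (ℤₚ.≤-reflexive (ℤₚ.*-identityʳ n))
        (ℤₚ.≤-<-trans (i≤∣i∣ n)
          (ℤₚ.<-≤-trans (ℤ.+<+ (ℕₚ.n<1+n ℤ.∣ n ∣))
            (ℤₚ.≤-trans (ℤ.+≤+ (ℕₚ.m≤m*n (suc ℤ.∣ n ∣) (suc d)))
              (ℤₚ.≤-reflexive (ℤₚ.pos-* (suc ℤ.∣ n ∣) (suc d)))))))))
    where
    i≤∣i∣ : ∀ i → i ℤ.≤ + ℤ.∣ i ∣
    i≤∣i∣ (+ _)       = ℤₚ.≤-refl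
    i≤∣i∣ ℤ.-[1+ _ ] = ℤ.-≤+

  /-≡ : ∀ i n .{{_ : NonZero n}} → + i / n ≡ ι i * (+ 1 / n)
  /-≡ i n@(suc n-1) = trans
    (ℚₚ.fromℚᵘ-cong {mkℚᵘ (+ i) n-1} {mkℚᵘ (+ i) 0 ℚᵘ.* mkℚᵘ (+ 1) n-1}
      (ℚᵘ.*≡* (cong₂ ℤ._*_ (sym (ℤₚ.*-identityʳ (+ i))) (cong +_ (ℕₚ.+-identityʳ n)))))
    (fromℚᵘ-homo-* (mkℚᵘ (+ i) 0) (mkℚᵘ (+ 1) n-1))

  n*1/n : ∀ n .{{_ : NonZero n}} → ι n * (+ 1 / n) ≡ 1ℚ
  n*1/n n@(suc n-1) = trans (sym (/-≡ n n))
    (ℚₚ.fromℚᵘ-cong {mkℚᵘ (+ n) n-1} {mkℚᵘ (+ 1) 0} (ℚᵘ.*≡* (ℤₚ.*-comm (+ n) (+ 1))))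

  0≤1/n : ∀ n .{{_ : NonZero n}} → 0ℚ ≤ + 1 / n
  0≤1/n n = ℚₚ.nonNegative⁻¹ (+ 1 / n) {{ℚₚ.normalize-nonNeg 1 n}}

  *-mono-≤ˡ : ∀ {p q} r → 0ℚ ≤ r → p ≤ q → r * p ≤ r * q
  *-mono-≤ˡ r 0≤r = ℚₚ.*-monoˡ-≤-nonNeg r {{nonNegative 0≤r}}

  *-mono-≤ʳ : ∀ {p q} r → 0ℚ ≤ r → p ≤ q → p * r ≤ q * r
  *-mono-≤ʳ r 0≤r = ℚₚ.*-monoʳ-≤-nonNeg r {{nonNegative 0≤r}}

  *-nonNeg : ∀ {p q} → 0ℚ ≤ p → 0ℚ ≤ q → 0ℚ ≤ p * q
  *-nonNeg {p} {q} 0≤p 0≤q = subst (_≤ p * q) (ℚₚ.*-zeroʳ p) (*-mono-≤ˡ p 0≤p 0≤q)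

  1/-* : ∀ m n .{{_ : NonZero m}} .{{_ : NonZero n}} .{{_ : NonZero (m ℕ.* n)}} →
         + 1 / (m ℕ.* n) ≡ (+ 1 / m) * (+ 1 / n)
  1/-* m n = begin
    t                              ≡⟨ ℚₚ.*-identityˡ t ⟨
    1ℚ * t                         ≡⟨ cong (_* t) (cong₂ _*_ (n*1/n m) (n*1/n n)) ⟨
    (ι m * r) * (ι n * s) * t      ≡⟨ solve 5 (λ a b c d e → (a :* b) :* (c :* d) :* e := (b :* d) :* (a :* c :* e)) refl (ι m) r (ι n) s t ⟩
    (r * s) * (ι m * ι n * t)      ≡⟨ cong (λ z → (r * s) * (z * t)) (ι-* m n) ⟨
    (r * s) * (ι (m ℕ.* n) * t)    ≡⟨ cong ((r * s) *_) (n*1/n (m ℕ.* n)) ⟩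
    (r * s) * 1ℚ                   ≡⟨ ℚₚ.*-identityʳ (r * s) ⟩
    r * s                          ∎
    where
    open ≡-Reasoning
    r = + 1 / m
    s = + 1 / n
    t = + 1 / (m ℕ.* n)

  k/n≤1 : ∀ k n .{{_ : NonZero n}} → k ℕ.≤ n → + k / n ≤ 1ℚ
  k/n≤1 k n k≤n = begin
    + k / n            ≡⟨ /-≡ k n ⟩
    ι k * (+ 1 / n)    ≤⟨ *-mono-≤ʳ (+ 1 / n) (0≤1/n n) (ι-mono-≤ k≤n) ⟩
    ι n * (+ 1 / n)    ≡⟨ n*1/n n ⟩
    1ℚ                 ∎
    where open ℚₚ.≤-Reasoning

  0≤k/n : ∀ k n .{{_ : NonZero n}} → 0ℚ ≤ + k / n
  0≤k/n k n = subst (0ℚ ≤_) (sym (/-≡ k n)) (*-nonNeg (0≤ι k) (0≤1/n n))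

  *-pos : ∀ {p q} → 0ℚ < p → 0ℚ < q → 0ℚ < p * q
  *-pos {p} {q} 0<p 0<q =
    subst (_< p * q) (ℚₚ.*-zeroʳ p) (ℚₚ.*-monoʳ-<-pos p {{positive 0<p}} 0<q)

  0<½ : 0ℚ < ½
  0<½ = ℚₚ.positive⁻¹ ½

  halves : ∀ ε → ε * ½ + ε * ½ ≡ ε
  halves = solve 1 (λ ε → ε :* con ½ :+ ε :* con ½ := ε) refl

  ≤-diff : ∀ {p q} → p - q ≤ 0ℚ → p ≤ q
  ≤-diff {p} {q} h = subst₂ _≤_
    (solve 2 (λ p q → p :- q :+ q := p) refl p q) (ℚₚ.+-identityˡ q) (ℚₚ.+-monoˡ-≤ q h)

  p≤∣p∣ : ∀ p → p ≤ ∣ p ∣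
  p≤∣p∣ p with ℚₚ.≤-total 0ℚ p
  ... | inj₁ 0≤p = ℚₚ.≤-reflexive (sym (ℚₚ.0≤p⇒∣p∣≡p 0≤p))
  ... | inj₂ p≤0 = ℚₚ.≤-trans p≤0 (ℚₚ.0≤∣p∣ p)

  ∣p-q∣-sym : ∀ p q → ∣ p - q ∣ ≡ ∣ q - p ∣
  ∣p-q∣-sym p q = trans (cong ∣_∣ (solve 2 (λ p q → p :- q := :- (q :- p)) refl p q))
                        (ℚₚ.∣-p∣≡∣p∣ (q - p))

  triangle : ∀ p q r → ∣ p - r ∣ ≤ ∣ p - q ∣ + ∣ q - r ∣
  triangle p q r = subst (λ z → ∣ z ∣ ≤ ∣ p - q ∣ + ∣ q - r ∣)
    (solve 3 (λ p q r → (p :- q) :+ (q :- r) := p :- r) refl p q r)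
    (ℚₚ.∣p+q∣≤∣p∣+∣q∣ (p - q) (q - r))

  ∣∣-≤ : ∀ {p c} → p ≤ c → - p ≤ c → ∣ p ∣ ≤ c
  ∣∣-≤ {p} {c} p≤c -p≤c with ℚₚ.∣p∣≡p∨∣p∣≡-p p
  ... | inj₁ eq = subst (_≤ c) (sym eq) p≤c
  ... | inj₂ eq = subst (_≤ c) (sym eq) -p≤c

  ∣∣p∣-∣q∣∣≤∣p-q∣ : ∀ p q → ∣ ∣ p ∣ - ∣ q ∣ ∣ ≤ ∣ p - q ∣
  ∣∣p∣-∣q∣∣≤∣p-q∣ p q = ∣∣-≤ (half p q)
    (subst₂ _≤_ (solve 2 (λ x y → y :- x := :- (x :- y)) refl ∣ p ∣ ∣ q ∣)
                (∣p-q∣-sym q p) (half q p))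
    where
    half : ∀ p q → ∣ p ∣ - ∣ q ∣ ≤ ∣ p - q ∣
    half p q = begin
      ∣ p ∣ - ∣ q ∣                  ≡⟨ cong (λ z → ∣ z ∣ - ∣ q ∣) (solve 2 (λ p q → p := p :- q :+ q) refl p q) ⟩
      ∣ p - q + q ∣ - ∣ q ∣          ≤⟨ ℚₚ.+-monoˡ-≤ (- ∣ q ∣) (ℚₚ.∣p+q∣≤∣p∣+∣q∣ (p - q) q) ⟩
      ∣ p - q ∣ + ∣ q ∣ - ∣ q ∣      ≡⟨ solve 2 (λ x y → x :+ y :- y := x) refl ∣ p - q ∣ ∣ q ∣ ⟩
      ∣ p - q ∣                      ∎
      where open ℚₚ.≤-Reasoning

------------------------------------------------------------------------
-- The real numbers, as Cauchy sequences of rationals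

IsCauchy : (ℕ → ℚ) → Set
IsCauchy x = ∀ ε → 0ℚ ℚ.< ε →
  ∃[ N ] ∀ m n → N ℕ.≤ m → N ℕ.≤ n → ℚ.∣ x m ℚ.- x n ∣ ℚ.< ε

record ℝ : Set where
  constructor real
  field
    seq    : ℕ → ℚ
    cauchy : IsCauchy seq

open ℝ public

module Cauchy where

  open import Data.Rational.Base hiding (NonZero; ℚ; 0ℚ; 1ℚ; ½; toℚᵘ; fromℚᵘ)
  open ℚ-Solver.+-*-Solver
  open ℚ-Lemmas

  const : ∀ q → IsCauchy (λ _ → q)
  const q ε 0<ε = 0 , λ _ _ _ _ → subst (_< ε) (cong ∣_∣ (sym (ℚₚ.+-inverseʳ q))) 0<ε

  plus : ∀ x y → IsCauchy x → IsCauchy y → IsCauchy (λ n → x n + y n)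
  plus x y cx cy ε 0<ε =
    let ε/2     = ε * ½
        0<ε/2   = *-pos 0<ε 0<½
        M , x<  = cx ε/2 0<ε/2
        N , y<  = cy ε/2 0<ε/2
    in M ℕ.⊔ N , λ m n M⊔N≤m M⊔N≤n → begin-strict
      ∣ (x m + y m) - (x n + y n) ∣    ≡⟨ cong ∣_∣ (solve 4 (λ a b c d → (a :+ b) :- (c :+ d) := (a :- c) :+ (b :- d)) refl (x m) (y m) (x n) (y n)) ⟩
      ∣ (x m - x n) + (y m - y n) ∣    ≤⟨ ℚₚ.∣p+q∣≤∣p∣+∣q∣ (x m - x n) (y m - y n) ⟩
      ∣ x m - x n ∣ + ∣ y m - y n ∣    <⟨ ℚₚ.+-mono-< (x< m n (ℕₚ.m⊔n≤o⇒m≤o M N M⊔N≤m) (ℕₚ.m⊔n≤o⇒m≤o M N M⊔N≤n))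
                                                      (y< m n (ℕₚ.m⊔n≤o⇒n≤o M N M⊔N≤m) (ℕₚ.m⊔n≤o⇒n≤o M N M⊔N≤n)) ⟩
      ε/2 + ε/2                        ≡⟨ halves ε ⟩
      ε                                ∎
    where open ℚₚ.≤-Reasoning

  negate : ∀ x → IsCauchy x → IsCauchy (λ n → - x n)
  negate x cx ε 0<ε = let N , x< = cx ε 0<ε in
    N , λ m n N≤m N≤n → subst (_< ε)
      (trans (sym (ℚₚ.∣-p∣≡∣p∣ (x m - x n)))
             (cong ∣_∣ (solve 2 (λ a b → :- (a :- b) := :- a :- (:- b)) refl (x m) (x n))))
      (x< m n N≤m N≤n)

  abs : ∀ x → IsCauchy x → IsCauchy (λ n → ∣ x n ∣)
  abs x cx ε 0<ε = let N , x< = cx ε 0<ε in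
    N , λ m n N≤m N≤n → ℚₚ.≤-<-trans (∣∣p∣-∣q∣∣≤∣p-q∣ (x m) (x n)) (x< m n N≤m N≤n)

  bounded : ∀ x → IsCauchy x → Σ[ B ∈ ℚ ] 0ℚ < B × ∃[ N ] ∀ n → N ℕ.≤ n → ∣ x n ∣ ≤ B
  bounded x cx =
    let N , x< = cx 1ℚ (ℚₚ.positive⁻¹ 1ℚ)
    in 1ℚ + ∣ x N ∣ ,
       ℚₚ.+-mono-<-≤ (ℚₚ.positive⁻¹ 1ℚ) (ℚₚ.0≤∣p∣ (x N)) ,
       N , λ n N≤n → begin
         ∣ x n ∣                  ≡⟨ cong ∣_∣ (solve 2 (λ a b → a := a :- b :+ b) refl (x n) (x N)) ⟩
         ∣ x n - x N + x N ∣      ≤⟨ ℚₚ.∣p+q∣≤∣p∣+∣q∣ (x n - x N) (x N) ⟩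
         ∣ x n - x N ∣ + ∣ x N ∣  ≤⟨ ℚₚ.+-monoˡ-≤ ∣ x N ∣ (ℚₚ.<⇒≤ (x< n N N≤n ℕₚ.≤-refl)) ⟩
         1ℚ + ∣ x N ∣             ∎
    where open ℚₚ.≤-Reasoning

  times : ∀ x y → IsCauchy x → IsCauchy y → IsCauchy (λ n → x n * y n)
  times x y cx cy ε 0<ε = K , λ m n K≤m K≤n → begin-strict
    ∣ x m * y m - x n * y n ∣                              ≡⟨ cong ∣_∣ (solve 4 (λ a b c d → a :* b :- c :* d := a :* (b :- d) :+ d :* (a :- c)) refl (x m) (y m) (x n) (y n)) ⟩
    ∣ x m * (y m - y n) + y n * (x m - x n) ∣              ≤⟨ ℚₚ.∣p+q∣≤∣p∣+∣q∣ (x m * (y m - y n)) (y n * (x m - x n)) ⟩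
    ∣ x m * (y m - y n) ∣ + ∣ y n * (x m - x n) ∣          ≡⟨ cong₂ _+_ (ℚₚ.∣p*q∣≡∣p∣*∣q∣ (x m) (y m - y n)) (ℚₚ.∣p*q∣≡∣p∣*∣q∣ (y n) (x m - x n)) ⟩
    ∣ x m ∣ * ∣ y m - y n ∣ + ∣ y n ∣ * ∣ x m - x n ∣      ≤⟨ ℚₚ.+-mono-≤
        (*-mono-≤ʳ ∣ y m - y n ∣ (ℚₚ.0≤∣p∣ (y m - y n)) (x≤ m (l₁ K≤m)))
        (*-mono-≤ʳ ∣ x m - x n ∣ (ℚₚ.0≤∣p∣ (x m - x n)) (y≤ n (l₂ K≤n))) ⟩
    B * ∣ y m - y n ∣ + C * ∣ x m - x n ∣                  <⟨ ℚₚ.+-mono-<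
        (ℚₚ.*-monoʳ-<-pos B {{positive 0<B}} (y< m n (l₄ K≤m) (l₄ K≤n)))
        (ℚₚ.*-monoʳ-<-pos C {{positive 0<C}} (x< m n (l₃ K≤m) (l₃ K≤n))) ⟩
    B * (ε/2 * 1/B) + C * (ε/2 * 1/C)                      ≡⟨ cong₂ _+_ (cancel B ε/2 {{B≢0}}) (cancel C ε/2 {{C≢0}}) ⟩
    ε/2 + ε/2                                              ≡⟨ halves ε ⟩
    ε                                                      ∎
    where
    open ℚₚ.≤-Reasoning
    cancel : ∀ b e .{{_ : ℚ.NonZero b}} → b * (e * (1/ b)) ≡ e
    cancel b e = trans (solve 3 (λ b e i → b :* (e :* i) := e :* (b :* i)) refl b e (1/ b))
                       (trans (cong (e *_) (ℚₚ.*-inverseʳ b)) (ℚₚ.*-identityʳ e))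
    ε/2 = ε * ½
    0<ε/2 = *-pos 0<ε 0<½
    bx = bounded x cx
    by = bounded y cy
    B = proj₁ bx
    C = proj₁ by
    0<B = proj₁ (proj₂ bx)
    0<C = proj₁ (proj₂ by)
    B≢0 = >-nonZero 0<B
    C≢0 = >-nonZero 0<C
    1/B = (1/ B) {{B≢0}}
    1/C = (1/ C) {{C≢0}}
    N₁ = proj₁ (proj₂ (proj₂ bx))
    N₂ = proj₁ (proj₂ (proj₂ by))
    x≤ = proj₂ (proj₂ (proj₂ bx))
    y≤ = proj₂ (proj₂ (proj₂ by))
    0<1/B = ℚₚ.positive⁻¹ 1/B {{ℚₚ.1/pos⇒pos B {{positive 0<B}}}}
    0<1/C = ℚₚ.positive⁻¹ 1/C {{ℚₚ.1/pos⇒pos C {{positive 0<C}}}}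
    cx' = cx (ε/2 * 1/C) (*-pos 0<ε/2 0<1/C)
    cy' = cy (ε/2 * 1/B) (*-pos 0<ε/2 0<1/B)
    N₃ = proj₁ cx'
    N₄ = proj₁ cy'
    x< = proj₂ cx'
    y< = proj₂ cy'
    K = (N₁ ℕ.⊔ N₂) ℕ.⊔ (N₃ ℕ.⊔ N₄)
    l₁ : ∀ {n} → K ℕ.≤ n → N₁ ℕ.≤ n
    l₁ h = ℕₚ.m⊔n≤o⇒m≤o N₁ N₂ (ℕₚ.m⊔n≤o⇒m≤o (N₁ ℕ.⊔ N₂) (N₃ ℕ.⊔ N₄) h)
    l₂ : ∀ {n} → K ℕ.≤ n → N₂ ℕ.≤ n
    l₂ h = ℕₚ.m⊔n≤o⇒n≤o N₁ N₂ (ℕₚ.m⊔n≤o⇒m≤o (N₁ ℕ.⊔ N₂) (N₃ ℕ.⊔ N₄) h)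
    l₃ : ∀ {n} → K ℕ.≤ n → N₃ ℕ.≤ n
    l₃ h = ℕₚ.m⊔n≤o⇒m≤o N₃ N₄ (ℕₚ.m⊔n≤o⇒n≤o (N₁ ℕ.⊔ N₂) (N₃ ℕ.⊔ N₄) h)
    l₄ : ∀ {n} → K ℕ.≤ n → N₄ ℕ.≤ n
    l₄ h = ℕₚ.m⊔n≤o⇒n≤o N₃ N₄ (ℕₚ.m⊔n≤o⇒n≤o (N₁ ℕ.⊔ N₂) (N₃ ℕ.⊔ N₄) h)

  fromRate : ∀ x C →
    (∀ m n → ∣ x m - x n ∣ ≤ C * (+ 1 / suc m) + C * (+ 1 / suc n)) → IsCauchy x
  fromRate x C rate ε 0<ε = N , λ m n N≤m N≤n → begin-strict
    ∣ x m - x n ∣                              ≤⟨ rate m n ⟩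
    C * (+ 1 / suc m) + C * (+ 1 / suc n)      <⟨ ℚₚ.+-mono-< (small m N≤m) (small n N≤n) ⟩
    ε/2 + ε/2                                  ≡⟨ halves ε ⟩
    ε                                          ∎
    where
    open ℚₚ.≤-Reasoning
    ε/2 = ε * ½
    0<ε/2 = *-pos 0<ε 0<½
    ε/2≢0 = >-nonZero 0<ε/2
    i = (1/ ε/2) {{ε/2≢0}}
    N = proj₁ (archimedean (C * i))
    C< : ∀ n → N ℕ.≤ n → C < ε/2 * ι (suc n)
    C< n N≤n = begin-strict
      C                    ≡⟨ ℚₚ.*-identityʳ C ⟨
      C * 1ℚ               ≡⟨ cong (C *_) (ℚₚ.*-inverseʳ ε/2 {{ε/2≢0}}) ⟨
      C * (ε/2 * i)        ≡⟨ solve 3 (λ c e i → c :* (e :* i) := e :* (c :* i)) refl C ε/2 i ⟩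
      ε/2 * (C * i)        <⟨ ℚₚ.*-monoʳ-<-pos ε/2 {{positive 0<ε/2}} (proj₂ (archimedean (C * i))) ⟩
      ε/2 * ι N            ≤⟨ *-mono-≤ˡ ε/2 (ℚₚ.<⇒≤ 0<ε/2) (ι-mono-≤ (ℕₚ.m≤n⇒m≤1+n N≤n)) ⟩
      ε/2 * ι (suc n)      ∎
    small : ∀ n → N ℕ.≤ n → C * (+ 1 / suc n) < ε/2
    small n N≤n = begin-strict
      C * (+ 1 / suc n)                    <⟨ ℚₚ.*-monoˡ-<-pos (+ 1 / suc n) {{ℚₚ.normalize-pos 1 (suc n)}} (C< n N≤n) ⟩
      ε/2 * ι (suc n) * (+ 1 / suc n)      ≡⟨ ℚₚ.*-assoc ε/2 (ι (suc n)) (+ 1 / suc n) ⟩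
      ε/2 * (ι (suc n) * (+ 1 / suc n))    ≡⟨ cong (ε/2 *_) (n*1/n (suc n)) ⟩
      ε/2 * 1ℚ                             ≡⟨ ℚₚ.*-identityʳ ε/2 ⟩
      ε/2                                  ∎

------------------------------------------------------------------------
-- Square roots of natural numbers

-- ⌊√m⌋
isqrt : ℕ → ℕ
isqrt zero = zero
isqrt (suc m) with suc (isqrt m) ℕ.* suc (isqrt m) ℕₚ.≤? suc m
... | yes _ = suc (isqrt m)
... | no  _ = isqrt m

isqrt-lower : ∀ m → isqrt m ℕ.* isqrt m ℕ.≤ m
isqrt-lower zero = ℕ.z≤n
isqrt-lower (suc m) with suc (isqrt m) ℕ.* suc (isqrt m) ℕₚ.≤? suc m
... | yes p = p
... | no  _ = ℕₚ.m≤n⇒m≤1+n (isqrt-lower m)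

isqrt-upper : ∀ m → m ℕ.< suc (isqrt m) ℕ.* suc (isqrt m)
isqrt-upper zero = ℕ.s≤s ℕ.z≤n
isqrt-upper (suc m) with suc (isqrt m) ℕ.* suc (isqrt m) ℕₚ.≤? suc m
... | yes _ = ℕₚ.≤-<-trans (isqrt-upper m)
                (ℕₚ.*-mono-< (ℕₚ.n<1+n (suc (isqrt m))) (ℕₚ.n<1+n (suc (isqrt m))))
... | no ¬p = ℕₚ.≰⇒> ¬p

-- With p = k + 1, the k-th term ⌊√(n·p²)⌋ / p is √n rounded down to a
-- multiple of 1/p.
√-seq : ℕ → ℕ → ℚ
√-seq n k = + isqrt (n ℕ.* (suc k ℕ.* suc k)) ℚ./ suc k

module √-Cauchy (n : ℕ) where

  open import Data.Rational.Base hiding (NonZero; ℚ; 0ℚ; 1ℚ; ½; toℚᵘ; fromℚᵘ)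
  open ℚ-Lemmas

  root : ℕ → ℕ
  root k = isqrt (n ℕ.* (suc k ℕ.* suc k))

  cross : ∀ j k → root k ℕ.* suc j ℕ.≤ suc (root j) ℕ.* suc k
  cross j k = ℕₚ.≮⇒≥ λ lt → ℕₚ.<-irrefl refl (begin-strict
    (a′ ℕ.* q) ℕ.* (a′ ℕ.* q)          <⟨ ℕₚ.*-mono-< lt lt ⟩
    (b ℕ.* p) ℕ.* (b ℕ.* p)            ≡⟨ solve 2 (λ b p → (b :* p) :* (b :* p) := (b :* b) :* (p :* p)) refl b p ⟩
    (b ℕ.* b) ℕ.* (p ℕ.* p)            ≤⟨ ℕₚ.*-monoˡ-≤ (p ℕ.* p) (isqrt-lower (n ℕ.* (q ℕ.* q))) ⟩
    (n ℕ.* (q ℕ.* q)) ℕ.* (p ℕ.* p)    ≡⟨ solve 3 (λ n p q → (n :* (q :* q)) :* (p :* p) := (n :* (p :* p)) :* (q :* q)) refl n p q ⟩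
    (n ℕ.* (p ℕ.* p)) ℕ.* (q ℕ.* q)    ≤⟨ ℕₚ.*-monoˡ-≤ (q ℕ.* q) (ℕₚ.<⇒≤ (isqrt-upper (n ℕ.* (p ℕ.* p)))) ⟩
    (a′ ℕ.* a′) ℕ.* (q ℕ.* q)          ≡⟨ solve 2 (λ a q → (a :* a) :* (q :* q) := (a :* q) :* (a :* q)) refl a′ q ⟩
    (a′ ℕ.* q) ℕ.* (a′ ℕ.* q)          ∎)
    where
    open ℕₚ.≤-Reasoning
    open ℕ-Solver.+-*-Solver
    p = suc j
    q = suc k
    a′ = suc (root j)
    b = root k

  half : ∀ j k → √-seq n k - √-seq n j ≤ + 1 / suc j
  half j k = begin
    + b / suc k - + a / suc j                ≡⟨ cong₂ _-_ (/-≡ b (suc k)) (/-≡ a (suc j)) ⟩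
    ι b * s - ι a * r                        ≡⟨ cong (λ z → z * s - ι a * r) (ℚₚ.*-identityʳ (ι b)) ⟨
    ι b * 1ℚ * s - ι a * r                   ≡⟨ cong (λ z → ι b * z * s - ι a * r) (n*1/n (suc j)) ⟨
    ι b * (ι p * r) * s - ι a * r            ≡⟨ cong (_- ι a * r) (solve 4 (λ b p r s → b :* (p :* r) :* s := (b :* p) :* (r :* s)) refl (ι b) (ι p) r s) ⟩
    (ι b * ι p) * (r * s) - ι a * r          ≡⟨ cong (λ z → z * (r * s) - ι a * r) (ι-* b p) ⟨
    ι (b ℕ.* p) * (r * s) - ι a * r          ≤⟨ ℚₚ.+-monoˡ-≤ (- (ι a * r)) (*-mono-≤ʳ (r * s) (*-nonNeg (0≤1/n p) (0≤1/n q)) (ι-mono-≤ (cross j k))) ⟩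
    ι (suc a ℕ.* q) * (r * s) - ι a * r      ≡⟨ cong (λ z → z * (r * s) - ι a * r) (trans (ι-* (suc a) q) (cong (_* ι q) (ι-+ 1 a))) ⟩
    (1ℚ + ι a) * ι q * (r * s) - ι a * r     ≡⟨ cong (_- ι a * r) (solve 4 (λ a q r s → (con 1ℚ :+ a) :* q :* (r :* s) := (con 1ℚ :+ a) :* r :* (q :* s)) refl (ι a) (ι q) r s) ⟩
    (1ℚ + ι a) * r * (ι q * s) - ι a * r     ≡⟨ cong (λ z → (1ℚ + ι a) * r * z - ι a * r) (n*1/n q) ⟩
    (1ℚ + ι a) * r * 1ℚ - ι a * r            ≡⟨ solve 2 (λ a r → (con 1ℚ :+ a) :* r :* con 1ℚ :- a :* r := r) refl (ι a) r ⟩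
    r                                        ∎
    where
    open ℚₚ.≤-Reasoning
    open ℚ-Solver.+-*-Solver
    p = suc j
    q = suc k
    a = root j
    b = root k
    r = + 1 / p
    s = + 1 / q

  rate : ∀ j k → ∣ √-seq n j - √-seq n k ∣ ≤ 1ℚ * (+ 1 / suc j) + 1ℚ * (+ 1 / suc k)
  rate j k = ∣∣-≤
    (begin
      √-seq n j - √-seq n k                          ≤⟨ half k j ⟩
      s                                              ≡⟨ solve 1 (λ s → s := con 0ℚ :+ con 1ℚ :* s) refl s ⟩
      0ℚ + 1ℚ * s                                    ≤⟨ ℚₚ.+-monoˡ-≤ (1ℚ * s) (*-nonNeg (0≤ι 1) (0≤1/n (suc j))) ⟩
      1ℚ * r + 1ℚ * s                                ∎)
    (begin
      - (√-seq n j - √-seq n k)                      ≡⟨ solve 2 (λ x y → :- (x :- y) := y :- x) refl (√-seq n j) (√-seq n k) ⟩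
      √-seq n k - √-seq n j                          ≤⟨ half j k ⟩
      r                                              ≡⟨ solve 1 (λ r → r := con 1ℚ :* r :+ con 0ℚ) refl r ⟩
      1ℚ * r + 0ℚ                                    ≤⟨ ℚₚ.+-monoʳ-≤ (1ℚ * r) (*-nonNeg (0≤ι 1) (0≤1/n (suc k))) ⟩
      1ℚ * r + 1ℚ * s                                ∎)
    where
    open ℚₚ.≤-Reasoning
    open ℚ-Solver.+-*-Solver
    r = + 1 / suc j
    s = + 1 / suc k

  cauchy-√ : IsCauchy (√-seq n)
  cauchy-√ = Cauchy.fromRate (√-seq n) 1ℚ rate

√ : ℕ → ℝ
√ n = real (√-seq n) (√-Cauchy.cauchy-√ n)

------------------------------------------------------------------------
-- The integral of a Lipschitz function over an interval with rational
-- endpoints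

-- The endpoints may come in either order.
record LipschitzOn (a b : ℚ) (f : ℚ → ℚ) : Set where
  field
    constant   : ℚ
    0≤constant : 0ℚ ℚ.≤ constant
    bound      : ∀ s t → a ℚ.⊓ b ℚ.≤ s → s ℚ.≤ a ℚ.⊔ b → a ℚ.⊓ b ℚ.≤ t → t ℚ.≤ a ℚ.⊔ b →
                 ℚ.∣ f s ℚ.- f t ∣ ℚ.≤ constant ℚ.* ℚ.∣ s ℚ.- t ∣

∑[_] : ℕ → (ℕ → ℚ) → ℚ
∑[ n ] f = sum ℚ.+-0-rawMonoid {n} (λ i → f (toℕ i))

node : ℚ → ℚ → (N : ℕ) .{{_ : NonZero N}} → ℕ → ℚ
node a b N i = a ℚ.+ (+ i ℚ./ N) ℚ.* (b ℚ.- a)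

riemannSum : (a b : ℚ) (f : ℚ → ℚ) (N : ℕ) .{{_ : NonZero N}} → ℚ
riemannSum a b f N = (b ℚ.- a) ℚ.* (+ 1 ℚ./ N) ℚ.* ∑[ N ] (λ i → f (node a b N i))

module Riemann-Cauchy (a b : ℚ) (f : ℚ → ℚ) (lip : LipschitzOn a b f) where

  open import Data.Rational.Base hiding (NonZero; ℚ; 0ℚ; 1ℚ; ½; toℚᵘ; fromℚᵘ)
  open ℚ-Lemmas
  open ℚ-Solver.+-*-Solver
  open LipschitzOn lip renaming (constant to L; 0≤constant to 0≤L)

  d = b - a

  node-between : ∀ N .{{_ : NonZero N}} k → k ℕ.≤ N →
                 a ⊓ b ≤ node a b N k × node a b N k ≤ a ⊔ b
  node-between N k k≤N =
    (begin
      lo                         ≡⟨ convex lo u ⟨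
      (1ℚ - u) * lo + u * lo     ≤⟨ ℚₚ.+-mono-≤ (*-mono-≤ˡ (1ℚ - u) 0≤1-u (ℚₚ.p⊓q≤p a b)) (*-mono-≤ˡ u 0≤u (ℚₚ.p⊓q≤q a b)) ⟩
      (1ℚ - u) * a + u * b       ≡⟨ shape ⟩
      node a b N k               ∎) ,
    (begin
      node a b N k               ≡⟨ shape ⟨
      (1ℚ - u) * a + u * b       ≤⟨ ℚₚ.+-mono-≤ (*-mono-≤ˡ (1ℚ - u) 0≤1-u (ℚₚ.p≤p⊔q a b)) (*-mono-≤ˡ u 0≤u (ℚₚ.p≤q⊔p a b)) ⟩
      (1ℚ - u) * hi + u * hi     ≡⟨ convex hi u ⟩
      hi                         ∎)
    where
    open ℚₚ.≤-Reasoning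
    u = + k / N
    lo = a ⊓ b
    hi = a ⊔ b
    0≤u = 0≤k/n k N
    0≤1-u : 0ℚ ≤ 1ℚ - u
    0≤1-u = subst (_≤ 1ℚ - u) (ℚₚ.+-inverseʳ u) (ℚₚ.+-monoˡ-≤ (- u) (k/n≤1 k N k≤N))
    convex : ∀ z u → (1ℚ - u) * z + u * z ≡ z
    convex = solve 2 (λ z u → (con 1ℚ :- u) :* z :+ u :* z := z) refl
    shape : (1ℚ - u) * a + u * b ≡ node a b N k
    shape = solve 3 (λ a b u → (con 1ℚ :- u) :* a :+ u :* b := a :+ u :* (b :- a)) refl a b u

  ∑-split : ∀ m n g → ∑[ m ℕ.+ n ] g ≡ ∑[ m ] g + ∑[ n ] (λ i → g (m ℕ.+ i))
  ∑-split zero    n g = sym (ℚₚ.+-identityˡ _)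
  ∑-split (suc m) n g = trans (cong (λ z → g 0 + z) (∑-split m n (λ i → g (suc i))))
                              (sym (ℚₚ.+-assoc (g 0) _ _))

  add-bounds : ∀ {v w c e} → ∣ v ∣ ≤ c → ∣ w ∣ ≤ e → ∣ v + w ∣ ≤ c + e
  add-bounds {v} {w} hv hw = ℚₚ.≤-trans (ℚₚ.∣p+q∣≤∣p∣+∣q∣ v w) (ℚₚ.+-mono-≤ hv hw)

  block : ∀ M v g c → (∀ j → j ℕ.< M → ∣ v - g j ∣ ≤ c) → ∣ ι M * v - ∑[ M ] g ∣ ≤ ι M * c
  block zero    v g c h = ℚₚ.≤-reflexive (trans
    (cong ∣_∣ (solve 1 (λ v → con 0ℚ :* v :- con 0ℚ := con 0ℚ) refl v)) (sym (ℚₚ.*-zeroˡ c)))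
  block (suc M) v g c h = subst₂ (λ y z → ∣ y ∣ ≤ z)
    (sym (trans (cong (λ z → z * v - (g 0 + S)) (ι-+ 1 M))
      (solve 4 (λ m v y s → (con 1ℚ :+ m) :* v :- (y :+ s) := (v :- y) :+ (m :* v :- s)) refl (ι M) v (g 0) S)))
    (sym (trans (cong (_* c) (ι-+ 1 M))
      (solve 2 (λ m c → (con 1ℚ :+ m) :* c := c :+ m :* c) refl (ι M) c)))
    (add-bounds (h 0 (ℕ.s≤s ℕ.z≤n)) (block M v (λ j → g (suc j)) c (λ j j<M → h (suc j) (ℕ.s≤s j<M))))
    where S = ∑[ M ] (λ j → g (suc j))

  blocks : ∀ N M u g c → (∀ i j → i ℕ.< N → j ℕ.< M → ∣ u i - g (i ℕ.* M ℕ.+ j) ∣ ≤ c) →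
           ∣ ι M * ∑[ N ] u - ∑[ N ℕ.* M ] g ∣ ≤ ι N * ι M * c
  blocks zero    M u g c h = ℚₚ.≤-reflexive (trans
    (cong ∣_∣ (solve 1 (λ m → m :* con 0ℚ :- con 0ℚ := con 0ℚ) refl (ι M)))
    (sym (solve 2 (λ m c → con 0ℚ :* m :* c := con 0ℚ) refl (ι M) c)))
  blocks (suc N) M u g c h = subst₂ (λ y z → ∣ y ∣ ≤ z)
    (sym (trans (cong (λ z → ι M * (u 0 + U) - z) (∑-split M (N ℕ.* M) g))
      (solve 5 (λ m u₀ u s t → m :* (u₀ :+ u) :- (s :+ t) := (m :* u₀ :- s) :+ (m :* u :- t)) refl
        (ι M) (u 0) U (∑[ M ] g) (∑[ N ℕ.* M ] g′))))
    (sym (trans (cong (λ z → z * ι M * c) (ι-+ 1 N))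
      (solve 3 (λ n m c → (con 1ℚ :+ n) :* m :* c := m :* c :+ n :* m :* c) refl (ι N) (ι M) c)))
    (add-bounds
      (block M (u 0) g c (λ j j<M → h 0 j (ℕ.s≤s ℕ.z≤n) j<M))
      (blocks N M (λ i → u (suc i)) g′ c λ i j i<N j<M →
        subst (λ z → ∣ u (suc i) - g z ∣ ≤ c) (ℕₚ.+-assoc M (i ℕ.* M) j) (h (suc i) j (ℕ.s≤s i<N) j<M)))
    where
    U = ∑[ N ] (λ i → u (suc i))
    g′ = λ k → g (M ℕ.+ k)

  module Refine (N M : ℕ) .{{_ : NonZero N}} .{{_ : NonZero M}} .{{_ : NonZero (N ℕ.* M)}} where

    open ℚₚ.≤-Reasoning

    r = + 1 / N
    s = + 1 / M
    t = + 1 / (N ℕ.* M)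
    c = L * (r * ∣ d ∣)

    node-diff : ∀ i j → node a b (N ℕ.* M) (i ℕ.* M ℕ.+ j) - node a b N i ≡ (ι j * s) * (r * d)
    node-diff i j = begin-equality
      (a + (+ k / (N ℕ.* M)) * d) - (a + (+ i / N) * d)    ≡⟨ cong₂ (λ y z → (a + y * d) - (a + z * d)) (/-≡ k (N ℕ.* M)) (/-≡ i N) ⟩
      (a + ι k * t * d) - (a + ι i * r * d)                ≡⟨ cong₂ (λ y z → (a + y * z * d) - (a + ι i * r * d))
                                                                (trans (ι-+ (i ℕ.* M) j) (cong (_+ ι j) (ι-* i M))) (1/-* N M) ⟩
      (a + (ι i * ι M + ι j) * (r * s) * d) - (a + ι i * r * d)
        ≡⟨ solve 7 (λ a i m j r s d → (a :+ (i :* m :+ j) :* (r :* s) :* d) :- (a :+ i :* r :* d)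
                      := (j :* s) :* (r :* d) :+ i :* r :* d :* (m :* s :- con 1ℚ)) refl a (ι i) (ι M) (ι j) r s d ⟩
      (ι j * s) * (r * d) + ι i * r * d * (ι M * s - 1ℚ)   ≡⟨ cong (λ z → (ι j * s) * (r * d) + ι i * r * d * (z - 1ℚ)) (n*1/n M) ⟩
      (ι j * s) * (r * d) + ι i * r * d * (1ℚ - 1ℚ)        ≡⟨ solve 2 (λ y z → y :+ z :* (con 1ℚ :- con 1ℚ) := y) refl ((ι j * s) * (r * d)) (ι i * r * d) ⟩
      (ι j * s) * (r * d)                                  ∎
      where k = i ℕ.* M ℕ.+ j

    index< : ∀ i j → i ℕ.< N → j ℕ.< M → i ℕ.* M ℕ.+ j ℕ.< N ℕ.* M
    index< i j i<N j<M = ℕₚ.<-≤-trans (ℕₚ.+-monoʳ-< (i ℕ.* M) j<M)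
      (ℕₚ.≤-trans (ℕₚ.≤-reflexive (ℕₚ.+-comm (i ℕ.* M) M)) (ℕₚ.*-monoˡ-≤ M i<N))

    close : ∀ i j → i ℕ.< N → j ℕ.< M →
            ∣ f (node a b N i) - f (node a b (N ℕ.* M) (i ℕ.* M ℕ.+ j)) ∣ ≤ c
    close i j i<N j<M = begin
      ∣ f x - f y ∣                      ≤⟨ bound x y (proj₁ x∈) (proj₂ x∈) (proj₁ y∈) (proj₂ y∈) ⟩
      L * ∣ x - y ∣                      ≡⟨ cong (L *_) (trans (∣p-q∣-sym x y) (cong ∣_∣ (node-diff i j))) ⟩
      L * ∣ (ι j * s) * (r * d) ∣        ≡⟨ cong (L *_) (trans (ℚₚ.∣p*q∣≡∣p∣*∣q∣ (ι j * s) (r * d))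
                                             (cong₂ _*_ (ℚₚ.0≤p⇒∣p∣≡p (*-nonNeg (0≤ι j) (0≤1/n M)))
                                                        (trans (ℚₚ.∣p*q∣≡∣p∣*∣q∣ r d) (cong (_* ∣ d ∣) (ℚₚ.0≤p⇒∣p∣≡p (0≤1/n N)))))) ⟩
      L * ((ι j * s) * (r * ∣ d ∣))      ≤⟨ *-mono-≤ˡ L 0≤L (*-mono-≤ʳ (r * ∣ d ∣) (*-nonNeg (0≤1/n N) (ℚₚ.0≤∣p∣ d))
                                             (*-mono-≤ʳ s (0≤1/n M) (ι-mono-≤ (ℕₚ.<⇒≤ j<M)))) ⟩
      L * ((ι M * s) * (r * ∣ d ∣))      ≡⟨ cong (λ z → L * (z * (r * ∣ d ∣))) (n*1/n M) ⟩
      L * (1ℚ * (r * ∣ d ∣))             ≡⟨ cong (L *_) (ℚₚ.*-identityˡ (r * ∣ d ∣)) ⟩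
      c                                  ∎
      where
      x = node a b N i
      y = node a b (N ℕ.* M) (i ℕ.* M ℕ.+ j)
      x∈ = node-between N i (ℕₚ.<⇒≤ i<N)
      y∈ = node-between (N ℕ.* M) (i ℕ.* M ℕ.+ j) (ℕₚ.<⇒≤ (index< i j i<N j<M))

    refine : ∣ riemannSum a b f N - riemannSum a b f (N ℕ.* M) ∣ ≤ L * ∣ d ∣ * ∣ d ∣ * r
    refine = begin
      ∣ d * r * U - d * t * V ∣                  ≡⟨ cong ∣_∣ (cong₂ (λ y z → d * r * y - d * z * V) (sym (ℚₚ.*-identityˡ U)) (1/-* N M)) ⟩
      ∣ d * r * (1ℚ * U) - d * (r * s) * V ∣     ≡⟨ cong (λ z → ∣ d * r * (z * U) - d * (r * s) * V ∣) (n*1/n M) ⟨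
      ∣ d * r * (ι M * s * U) - d * (r * s) * V ∣
        ≡⟨ cong ∣_∣ (solve 6 (λ d r s m u v → d :* r :* (m :* s :* u) :- d :* (r :* s) :* v := (d :* (r :* s)) :* (m :* u :- v)) refl d r s (ι M) U V) ⟩
      ∣ (d * (r * s)) * (ι M * U - V) ∣          ≡⟨ ℚₚ.∣p*q∣≡∣p∣*∣q∣ (d * (r * s)) (ι M * U - V) ⟩
      ∣ d * (r * s) ∣ * ∣ ι M * U - V ∣          ≡⟨ cong (_* ∣ ι M * U - V ∣) (trans (ℚₚ.∣p*q∣≡∣p∣*∣q∣ d (r * s)) (cong (∣ d ∣ *_) (ℚₚ.0≤p⇒∣p∣≡p 0≤rs))) ⟩
      ∣ d ∣ * (r * s) * ∣ ι M * U - V ∣          ≤⟨ *-mono-≤ˡ (∣ d ∣ * (r * s)) (*-nonNeg (ℚₚ.0≤∣p∣ d) 0≤rs)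
                                                    (blocks N M (λ i → f (node a b N i)) (λ k → f (node a b (N ℕ.* M) k)) c close) ⟩
      ∣ d ∣ * (r * s) * (ι N * ι M * c)
        ≡⟨ solve 7 (λ e r s n m l c → e :* (r :* s) :* (n :* m :* (l :* (c :* e))) := l :* e :* e :* c :* ((n :* r) :* (m :* s))) refl ∣ d ∣ r s (ι N) (ι M) L r ⟩
      L * ∣ d ∣ * ∣ d ∣ * r * ((ι N * r) * (ι M * s))    ≡⟨ cong (L * ∣ d ∣ * ∣ d ∣ * r *_) (cong₂ _*_ (n*1/n N) (n*1/n M)) ⟩
      L * ∣ d ∣ * ∣ d ∣ * r * (1ℚ * 1ℚ)          ≡⟨ ℚₚ.*-identityʳ _ ⟩
      L * ∣ d ∣ * ∣ d ∣ * r                      ∎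
      where
      U = ∑[ N ] (λ i → f (node a b N i))
      V = ∑[ N ℕ.* M ] (λ k → f (node a b (N ℕ.* M) k))
      0≤rs = *-nonNeg (0≤1/n N) (0≤1/n M)

  open Refine using (refine)

  riemannSum-cong : ∀ {N M} .{{_ : NonZero N}} .{{_ : NonZero M}} → N ≡ M →
                    riemannSum a b f N ≡ riemannSum a b f M
  riemannSum-cong refl = refl

  rate : ∀ m n → ∣ riemannSum a b f (suc m) - riemannSum a b f (suc n) ∣
               ≤ L * ∣ d ∣ * ∣ d ∣ * (+ 1 / suc m) + L * ∣ d ∣ * ∣ d ∣ * (+ 1 / suc n)
  rate m n = begin
    ∣ S - T ∣                          ≤⟨ triangle S R T ⟩
    ∣ S - R ∣ + ∣ R - T ∣              ≤⟨ ℚₚ.+-mono-≤ (refine N M) R-T ⟩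
    L * ∣ d ∣ * ∣ d ∣ * (+ 1 / N) + L * ∣ d ∣ * ∣ d ∣ * (+ 1 / M) ∎
    where
    open ℚₚ.≤-Reasoning
    N = suc m
    M = suc n
    S = riemannSum a b f N
    T = riemannSum a b f M
    R = riemannSum a b f (N ℕ.* M)
    R-T : ∣ R - T ∣ ≤ L * ∣ d ∣ * ∣ d ∣ * (+ 1 / M)
    R-T = subst (_≤ L * ∣ d ∣ * ∣ d ∣ * (+ 1 / M))
      (trans (∣p-q∣-sym T (riemannSum a b f (M ℕ.* N)))
             (cong (λ z → ∣ z - T ∣) (riemannSum-cong (ℕₚ.*-comm M N))))
      (refine M N)

  cauchy-∫ : IsCauchy (λ n → riemannSum a b f (suc n))
  cauchy-∫ = Cauchy.fromRate (λ n → riemannSum a b f (suc n)) (L * ∣ d ∣ * ∣ d ∣) rate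

-- The limit of the Riemann sums over N = 1, 2, … equal subintervals; for
-- b < a it is minus the integral from b to a.
∫ : (a b : ℚ) (f : ℚ → ℚ) → LipschitzOn a b f → ℝ
∫ a b f lip = real (λ n → riemannSum a b f (suc n)) (Riemann-Cauchy.cauchy-∫ a b f lip)

------------------------------------------------------------------------
-- The natural logarithm: log x = ∫₁ˣ dt/t

-- 1/t, with the conventional value 0 at t = 0, which is never used below
-- since the interval of integration consists of positive numbers.
recip : ℚ → ℚ
recip t with t ℚₚ.≟ 0ℚ
... | yes _   = 0ℚ
... | no  t≢0 = (ℚ.1/ t) {{ℚ.≢-nonZero t≢0}}

module Recip-Lipschitz (x : ℚ) (0<x : 0ℚ ℚ.< x) where

  open import Data.Rational.Base hiding (NonZero; ℚ; 0ℚ; 1ℚ; ½; toℚᵘ; fromℚᵘ)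
  open ℚ-Lemmas
  open ℚ-Solver.+-*-Solver

  recip-inverse : ∀ t → 0ℚ < t → t * recip t ≡ 1ℚ
  recip-inverse t 0<t with t ℚₚ.≟ 0ℚ
  ... | yes t≡0 = contradiction (sym t≡0) (ℚₚ.<⇒≢ 0<t)
  ... | no  t≢0 = ℚₚ.*-inverseʳ t {{≢-nonZero t≢0}}

  0≤recip : ∀ t → 0ℚ < t → 0ℚ ≤ recip t
  0≤recip t 0<t = ℚₚ.*-cancelˡ-≤-pos t {{positive 0<t}}
    (subst₂ _≤_ (sym (ℚₚ.*-zeroʳ t)) (sym (recip-inverse t 0<t)) (0≤ι 1))

  recip-antitone : ∀ s t → 0ℚ < s → s ≤ t → recip t ≤ recip s
  recip-antitone s t 0<s s≤t = begin
    recip t                          ≡⟨ ℚₚ.*-identityʳ (recip t) ⟨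
    recip t * 1ℚ                     ≡⟨ cong (recip t *_) (recip-inverse s 0<s) ⟨
    recip t * (s * recip s)          ≤⟨ *-mono-≤ˡ (recip t) (0≤recip t 0<t) (*-mono-≤ʳ (recip s) (0≤recip s 0<s) s≤t) ⟩
    recip t * (t * recip s)          ≡⟨ solve 3 (λ i t j → i :* (t :* j) := (t :* i) :* j) refl (recip t) t (recip s) ⟩
    (t * recip t) * recip s          ≡⟨ cong (_* recip s) (recip-inverse t 0<t) ⟩
    1ℚ * recip s                     ≡⟨ ℚₚ.*-identityˡ (recip s) ⟩
    recip s                          ∎
    where
    open ℚₚ.≤-Reasoning
    0<t = ℚₚ.<-≤-trans 0<s s≤t

  lo = 1ℚ ⊓ x

  0<lo : 0ℚ < lo
  0<lo with ℚₚ.≤-total 1ℚ x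
  ... | inj₁ 1≤x = subst (0ℚ <_) (sym (ℚₚ.p≤q⇒p⊓q≡p 1≤x)) (ℚₚ.positive⁻¹ 1ℚ)
  ... | inj₂ x≤1 = subst (0ℚ <_) (sym (ℚₚ.p≥q⇒p⊓q≡q x≤1)) 0<x

  k = recip lo
  0≤k = 0≤recip lo 0<lo

  recip-bound : ∀ s t → lo ≤ s → lo ≤ t → ∣ recip s - recip t ∣ ≤ k * k * ∣ s - t ∣
  recip-bound s t lo≤s lo≤t = begin
    ∣ i - j ∣                                    ≡⟨ cong ∣_∣ (cong₂ _-_ (ℚₚ.*-identityʳ i) (ℚₚ.*-identityʳ j)) ⟨
    ∣ i * 1ℚ - j * 1ℚ ∣                          ≡⟨ cong ∣_∣ (cong₂ (λ y z → i * y - j * z) (recip-inverse t 0<t) (recip-inverse s 0<s)) ⟨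
    ∣ i * (t * j) - j * (s * i) ∣                ≡⟨ cong ∣_∣ (solve 4 (λ i j s t → i :* (t :* j) :- j :* (s :* i) := (i :* j) :* (t :- s)) refl i j s t) ⟩
    ∣ (i * j) * (t - s) ∣                        ≡⟨ ℚₚ.∣p*q∣≡∣p∣*∣q∣ (i * j) (t - s) ⟩
    ∣ i * j ∣ * ∣ t - s ∣                        ≡⟨ cong₂ _*_ (ℚₚ.0≤p⇒∣p∣≡p (*-nonNeg 0≤i 0≤j)) (∣p-q∣-sym t s) ⟩
    i * j * ∣ s - t ∣                            ≤⟨ *-mono-≤ʳ ∣ s - t ∣ (ℚₚ.0≤∣p∣ (s - t)) (ℚₚ.≤-trans
                                                      (*-mono-≤ʳ j 0≤j (recip-antitone lo s 0<lo lo≤s))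
                                                      (*-mono-≤ˡ k 0≤k (recip-antitone lo t 0<lo lo≤t))) ⟩
    k * k * ∣ s - t ∣                            ∎
    where
    open ℚₚ.≤-Reasoning
    i = recip s
    j = recip t
    0<s = ℚₚ.<-≤-trans 0<lo lo≤s
    0<t = ℚₚ.<-≤-trans 0<lo lo≤t
    0≤i = 0≤recip s 0<s
    0≤j = 0≤recip t 0<t

  lipschitz : LipschitzOn 1ℚ x recip
  lipschitz = record
    { constant   = k * k
    ; 0≤constant = *-nonNeg 0≤k 0≤k
    ; bound      = λ s t lo≤s _ lo≤t _ → recip-bound s t lo≤s lo≤t
    }

log : (x : ℚ) .{{_ : ℚ.Positive x}} → ℝ
log x = ∫ 1ℚ x recip (Recip-Lipschitz.lipschitz x (ℚₚ.positive⁻¹ x))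

------------------------------------------------------------------------
-- Arithmetic and order of ℝ

infixl 7 _*_
infixl 6 _+_ _-_
infix  8 -_

fromℚ : ℚ → ℝ
fromℚ q = real (λ _ → q) (Cauchy.const q)

fromℕ : ℕ → ℝ
fromℕ n = fromℚ (+ n ℚ./ 1)

_+_ : ℝ → ℝ → ℝ
x + y = real (λ n → seq x n ℚ.+ seq y n) (Cauchy.plus (seq x) (seq y) (cauchy x) (cauchy y))

-_ : ℝ → ℝ
- x = real (λ n → ℚ.- seq x n) (Cauchy.negate (seq x) (cauchy x))

_-_ : ℝ → ℝ → ℝ
x - y = x + - y

_*_ : ℝ → ℝ → ℝ
x * y = real (λ n → seq x n ℚ.* seq y n) (Cauchy.times (seq x) (seq y) (cauchy x) (cauchy y))

∣_∣ : ℝ → ℝ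
∣ x ∣ = real (λ n → ℚ.∣ seq x n ∣) (Cauchy.abs (seq x) (cauchy x))

infix 4 _≤_ _<_

_≤_ : ℝ → ℝ → Set
x ≤ y = ∀ ε → 0ℚ ℚ.< ε → ∃[ N ] ∀ n → N ℕ.≤ n → seq x n ℚ.≤ seq y n ℚ.+ ε

_<_ : ℝ → ℝ → Set
x < y = Σ[ ε ∈ ℚ ] 0ℚ ℚ.< ε × ∃[ N ] ∀ n → N ℕ.≤ n → seq x n ℚ.+ ε ℚ.≤ seq y n

------------------------------------------------------------------------
-- Asymptotics of real sequences indexed by the positive integers

Sequence : Set
Sequence = (n : ℕ) .{{_ : NonZero n}} → ℝ

infix 4 _=O_

_=O_ : Sequence → Sequence → Set
f =O g = Σ[ M ∈ ℝ ] ∃[ a ] ∀ n .{{_ : NonZero n}} → a ℕ.≤ n → ∣ f n ∣ ≤ M * g n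

Limit : Sequence → ℝ → Set
Limit f ℓ = ∀ ε → fromℕ 0 < ε →
  ∃[ N ] ∀ n .{{_ : NonZero n}} → N ℕ.≤ n → ∣ f n - ℓ ∣ < ε

-- Put mₖ = ⌊n/k⌋. The parity of m is Σ_{j<J} ([2j+1 ≤ m] − [2j+2 ≤ m]) up to
-- an error in [0, [2J+1 ≤ m]], and Σ_{k≤n} [d ≤ mₖ] = ⌊n/d⌋; hence 𝓕 n equals
-- Σ_{j<J} (⌊n/(2j+1)⌋ − ⌊n/(2j+2)⌋) up to ⌊n/(2J+1)⌋. Dropping the floors costs
-- at most J and leaves n (1 − 1/2 + … − 1/(2J)) = n (1/(J+1) + … + 1/(2J)), a
-- Riemann sum of ∫₁² dt/t up to 1/J, so within O(1/J) of log 2. With J = ⌊√n⌋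
-- all the errors are O(√n).

module Submission where

import Algebra.Properties.Semiring.Sum as SemiringSum
open import Algebra.Bundles using (CommutativeRing)
open import Data.Fin.Base using (toℕ)
open import Data.Integer.Base using (+_)
open import Data.List.Base using (length; filter; applyUpTo)
open import Data.Nat.Base as ℕ using (ℕ; zero; suc; NonZero)
import Data.Nat.DivMod as ℕₚ
import Data.Nat.Properties as ℕₚ
import Data.Nat.Solver as ℕ-Solver
open import Data.Product.Base using (_×_; ∃-syntax; _,_; proj₁; proj₂)
open import Data.Rational.Base as ℚ using (_/_; ½)
import Data.Rational.Properties as ℚₚ
import Data.Rational.Solver as ℚ-Solver
open import Function.Base using (id)
open import Relation.Binary.PropositionalEquality hiding (J)
open import Relation.Nullary using (¬_; yes; no; contradiction)

module Rational where

  open import Data.Rational.Base hiding (NonZero)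
  open import Defs using (𝓕; ∑[_]; node; recip; log; seq; isqrt; isqrt-lower; isqrt-upper; √-seq;
                          module ℚ-Lemmas; module Riemann-Cauchy; module Recip-Lipschitz; module LipschitzOn)
  open ℚ-Lemmas
  open ℚ-Solver.+-*-Solver
  open SemiringSum (CommutativeRing.semiring ℚₚ.+-*-commutativeRing)
    using (sum-cong-≗; ∑-comm; *-distribˡ-sum; sum-replicate-zero)

  -- Order in ℚ.

  2ℚ : ℚ
  2ℚ = + 2 / 1

  0<2 : 0ℚ < 2ℚ
  0<2 = ℚₚ.positive⁻¹ 2ℚ

  1/[1+_] : ℕ → ℚ
  1/[1+ k ] = + 1 / suc k

  p-q≤p : ∀ {p q} → 0ℚ ≤ q → p - q ≤ p
  p-q≤p {p} {q} 0≤q = subst (p - q ≤_) (ℚₚ.+-identityʳ p) (ℚₚ.+-monoʳ-≤ p (ℚₚ.neg-antimono-≤ 0≤q))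

  ≤⇒0≤- : ∀ {p q} → p ≤ q → 0ℚ ≤ q - p
  ≤⇒0≤- {p} {q} p≤q = subst (_≤ q - p) (ℚₚ.+-inverseʳ p) (ℚₚ.+-monoˡ-≤ (- p) p≤q)

  0≤-⇒≤ : ∀ {p q} → 0ℚ ≤ q - p → p ≤ q
  0≤-⇒≤ {p} {q} 0≤q-p = ≤-diff (subst (_≤ 0ℚ)
    (solve 2 (λ p q → :- (q :- p) := p :- q) refl p q) (ℚₚ.neg-antimono-≤ 0≤q-p))

  ∣p-q∣≤r : ∀ {p q r} → 0ℚ ≤ p → p ≤ r → 0ℚ ≤ q → q ≤ r → ∣ p - q ∣ ≤ r
  ∣p-q∣≤r {p} {q} {r} 0≤p p≤r 0≤q q≤r = ∣∣-≤ (ℚₚ.≤-trans (p-q≤p 0≤q) p≤r)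
    (subst (_≤ r) (solve 2 (λ p q → q :- p := :- (p :- q)) refl p q) (ℚₚ.≤-trans (p-q≤p 0≤p) q≤r))

  -- Finite sums

  ∑-cong : ∀ n {f g : ℕ → ℚ} → (∀ i → f i ≡ g i) → ∑[ n ] f ≡ ∑[ n ] g
  ∑-cong n f≗g = sum-cong-≗ {n} (λ i → f≗g (toℕ i))

  ∑-swap : ∀ m n (f : ℕ → ℕ → ℚ) → ∑[ m ] (λ i → ∑[ n ] (f i)) ≡ ∑[ n ] (λ j → ∑[ m ] (λ i → f i j))
  ∑-swap m n f = ∑-comm {m} {n} (λ i j → f (toℕ i) (toℕ j))

  *-distribˡ-∑ : ∀ n x f → x * ∑[ n ] f ≡ ∑[ n ] (λ i → x * f i)
  *-distribˡ-∑ n x f = *-distribˡ-sum {n} x (λ i → f (toℕ i))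

  ∑-zero : ∀ n → ∑[ n ] (λ _ → 0ℚ) ≡ 0ℚ
  ∑-zero = sum-replicate-zero

  ∑-distrib-- : ∀ n f g → ∑[ n ] (λ i → f i - g i) ≡ ∑[ n ] f - ∑[ n ] g
  ∑-distrib-- zero    f g = refl
  ∑-distrib-- (suc n) f g = trans
    (cong (λ z → f 0 - g 0 + z) (∑-distrib-- n (λ i → f (suc i)) (λ i → g (suc i))))
    (solve 4 (λ a b c d → a :- b :+ (c :- d) := (a :+ c) :- (b :+ d)) refl
      (f 0) (g 0) (∑[ n ] (λ i → f (suc i))) (∑[ n ] (λ i → g (suc i))))

  ∑-mono-≤ : ∀ n {f g} → (∀ i → f i ≤ g i) → ∑[ n ] f ≤ ∑[ n ] g
  ∑-mono-≤ zero    f≤g = ℚₚ.≤-refl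
  ∑-mono-≤ (suc n) f≤g = ℚₚ.+-mono-≤ (f≤g 0) (∑-mono-≤ n (λ i → f≤g (suc i)))

  ∣∑∣≤n : ∀ n f → (∀ i → ∣ f i ∣ ≤ 1ℚ) → ∣ ∑[ n ] f ∣ ≤ ι n
  ∣∑∣≤n zero    f ∣f∣≤1 = ℚₚ.≤-refl
  ∣∑∣≤n (suc n) f ∣f∣≤1 = begin
    ∣ f 0 + ∑[ n ] f′ ∣        ≤⟨ ℚₚ.∣p+q∣≤∣p∣+∣q∣ (f 0) (∑[ n ] f′) ⟩
    ∣ f 0 ∣ + ∣ ∑[ n ] f′ ∣    ≤⟨ ℚₚ.+-mono-≤ (∣f∣≤1 0) (∣∑∣≤n n f′ (λ i → ∣f∣≤1 (suc i))) ⟩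
    1ℚ + ι n                   ≡⟨ ι-+ 1 n ⟨
    ι (suc n)                  ∎
    where
    open ℚₚ.≤-Reasoning
    f′ = λ i → f (suc i)

  ∑-telescope : ∀ n f → ∑[ n ] (λ i → f i - f (suc i)) ≡ f 0 - f n
  ∑-telescope zero    f = sym (ℚₚ.+-inverseʳ (f 0))
  ∑-telescope (suc n) f = trans
    (cong (λ z → f 0 - f 1 + z) (∑-telescope n (λ i → f (suc i))))
    (solve 3 (λ a b c → a :- b :+ (b :- c) := a :- c) refl (f 0) (f 1) (f (suc n)))

  ∑-pairs : ∀ n f → ∑[ n ℕ.* 2 ] f ≡ ∑[ n ] (λ i → f (i ℕ.* 2) + f (suc (i ℕ.* 2)))
  ∑-pairs zero    f = refl
  ∑-pairs (suc n) f = trans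
    (cong (λ z → f 0 + (f 1 + z)) (∑-pairs n (λ i → f (suc (suc i)))))
    (sym (ℚₚ.+-assoc (f 0) (f 1) _))

  -- Counting with indicators

  -- The indicator of d ≤ m. Recursion on both arguments lets equal shifts of d and m cancel by
  -- computation, which `∑χ` and `parity-error` rely on.
  χ : ℕ → ℕ → ℚ
  χ zero    _       = 1ℚ
  χ (suc _) zero    = 0ℚ
  χ (suc d) (suc m) = χ d m

  χ-≤ : ∀ {d m} → d ℕ.≤ m → χ d m ≡ 1ℚ
  χ-≤ ℕ.z≤n       = refl
  χ-≤ (ℕ.s≤s d≤m) = χ-≤ d≤m

  χ-≰ : ∀ {d m} → ¬ d ℕ.≤ m → χ d m ≡ 0ℚ
  χ-≰ {zero}          d≰m = contradiction ℕ.z≤n d≰m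
  χ-≰ {suc d} {zero}  d≰m = refl
  χ-≰ {suc d} {suc m} d≰m = χ-≰ (λ d≤m → d≰m (ℕ.s≤s d≤m))

  χ-cong : ∀ {d m d′ m′} → (d ℕ.≤ m → d′ ℕ.≤ m′) → (d′ ℕ.≤ m′ → d ℕ.≤ m) → χ d m ≡ χ d′ m′
  χ-cong {d} {m} to from with d ℕₚ.≤? m
  ... | yes d≤m = trans (χ-≤ d≤m) (sym (χ-≤ (to d≤m)))
  ... | no  d≰m = trans (χ-≰ d≰m) (sym (χ-≰ (λ d′≤m′ → d≰m (from d′≤m′))))

  ∑χ : ∀ {N q} → q ℕ.≤ N → ∑[ N ] (λ k → χ (suc k) q) ≡ ι q
  ∑χ {N}         ℕ.z≤n             = ∑-zero N
  ∑χ {suc N} {suc q} (ℕ.s≤s q≤N) = trans (cong (λ z → 1ℚ + z) (∑χ q≤N)) (sym (ι-+ 1 q))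

  *≤⇒≤/ : ∀ d {n} k .{{_ : NonZero k}} → d ℕ.* k ℕ.≤ n → d ℕ.≤ n ℕ./ k
  *≤⇒≤/ d {n} k dk≤n = subst (ℕ._≤ n ℕ./ k) (ℕₚ.m*n/n≡m d k) (ℕₚ./-monoˡ-≤ k dk≤n)

  ≤/⇒*≤ : ∀ d {n} k .{{_ : NonZero k}} → d ℕ.≤ n ℕ./ k → d ℕ.* k ℕ.≤ n
  ≤/⇒*≤ d {n} k d≤n/k = ℕₚ.≤-trans (ℕₚ.*-monoˡ-≤ k d≤n/k) (ℕₚ.m/n*n≤m n k)

  -- Both d ≤ ⌊n/k⌋ and k ≤ ⌊n/d⌋ say that dk ≤ n.
  χ-/-comm : ∀ n d k .{{_ : NonZero d}} .{{_ : NonZero k}} → χ d (n ℕ./ k) ≡ χ k (n ℕ./ d)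
  χ-/-comm n d k = χ-cong {d} {n ℕ./ k} {k} {n ℕ./ d}
    (λ d≤n/k → *≤⇒≤/ k d (subst (ℕ._≤ n) (ℕₚ.*-comm d k) (≤/⇒*≤ d k d≤n/k)))
    (λ k≤n/d → *≤⇒≤/ d k (subst (ℕ._≤ n) (ℕₚ.*-comm k d) (≤/⇒*≤ k d k≤n/d)))

  -- After the exchange of d and k the sum counts the k with 1 ≤ k ≤ ⌊n/d⌋, and ⌊n/d⌋ ≤ n keeps them
  -- all in range.
  ∑χ-/ : ∀ n d .{{_ : NonZero d}} → ∑[ n ] (λ k → χ d (n ℕ./ suc k)) ≡ ι (n ℕ./ d)
  ∑χ-/ n d = trans (∑-cong n (λ k → χ-/-comm n d (suc k))) (∑χ (ℕₚ.m/n≤m n d))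

  -- A remainder mod 2 is its own indicator of oddness. Stated for `applyUpTo f` so that the
  -- induction can shift `f`; `upTo` is the case `f = id`.
  length-filter : ∀ (a : ℕ → ℕ) f n →
    ι (length (filter (λ j → a j ℕ.% 2 ℕₚ.≟ 1) (applyUpTo f n))) ≡ ∑[ n ] (λ k → ι (a (f k) ℕ.% 2))
  length-filter a f zero = refl
  length-filter a f (suc n)
    with a (f 0) ℕ.% 2 | ℕₚ.m%n<n (a (f 0)) 2 | length-filter a (λ k → f (suc k)) n
  ... | 0 | _ | ih = trans ih (sym (ℚₚ.+-identityˡ _))
  ... | 1 | _ | ih = trans
    (ι-+ 1 (length (filter (λ j → a j ℕ.% 2 ℕₚ.≟ 1) (applyUpTo (λ k → f (suc k)) n)))) (cong (λ z → 1ℚ + z) ih)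
  ... | suc (suc _) | ℕ.s≤s (ℕ.s≤s ()) | _

  -- Equals the parity of m as long as m ≤ 2 J, and 0 afterwards.
  parity : ℕ → ℕ → ℚ
  parity J m = ∑[ J ] (λ j → χ (suc (j ℕ.* 2)) m - χ (suc (suc (j ℕ.* 2))) m)

  -- Lowering m by 2 and J by 1 preserves everything: for m ≥ 2 the first summand is 1 - 1, and the
  -- others shift by computation. At J = 0 the error is the parity itself. For J > 0 and m ≤ 1 all
  -- summands after the first are 0 - 0, and the first one equals m.
  parity-error : ∀ J m → 0ℚ ≤ ι (m ℕ.% 2) - parity J m × ι (m ℕ.% 2) - parity J m ≤ χ (suc (J ℕ.* 2)) m
  parity-error zero zero = ℚₚ.≤-refl , ℚₚ.≤-refl
  parity-error zero m@(suc _) =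
    ℚₚ.≤-trans (0≤ι (m ℕ.% 2)) (ℚₚ.≤-reflexive eq) ,
    ℚₚ.≤-trans (ℚₚ.≤-reflexive (sym eq)) (ι-mono-≤ (ℕ.s≤s⁻¹ (ℕₚ.m%n<n m 2)))
    where
    eq : ι (m ℕ.% 2) ≡ ι (m ℕ.% 2) - 0ℚ
    eq = sym (ℚₚ.+-identityʳ _)
  parity-error (suc J) zero =
    subst (λ z → 0ℚ ≤ 0ℚ - (0ℚ + z) × 0ℚ - (0ℚ + z) ≤ 0ℚ) (sym (∑-zero J)) (ℚₚ.≤-refl , ℚₚ.≤-refl)
  parity-error (suc J) (suc zero) =
    subst (λ z → 0ℚ ≤ 1ℚ - (1ℚ + z) × 1ℚ - (1ℚ + z) ≤ 0ℚ) (sym (∑-zero J)) (ℚₚ.≤-refl , ℚₚ.≤-refl)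
  parity-error (suc J) (suc (suc m)) =
    subst (λ z → 0ℚ ≤ ι (m ℕ.% 2) - z × ι (m ℕ.% 2) - z ≤ χ (suc (J ℕ.* 2)) m)
      (sym (ℚₚ.+-identityˡ (parity J m))) (parity-error J m)

  -- The count against alternating sums of floors.

  altFloors : ℕ → ℕ → ℚ
  altFloors n J = ∑[ J ] (λ j → ι (n ℕ./ suc (j ℕ.* 2)) - ι (n ℕ./ suc (suc (j ℕ.* 2))))

  -- Summing over k before j turns each indicator into a floor by `∑χ-/`.
  𝓕-altFloors : ∀ n J → ∑[ n ] (λ k → ι ((n ℕ./ suc k) ℕ.% 2) - parity J (n ℕ./ suc k)) ≡ ι (𝓕 n) - altFloors n J
  𝓕-altFloors n J = trans
    (∑-distrib-- n (λ k → ι ((n ℕ./ suc k) ℕ.% 2)) (λ k → parity J (n ℕ./ suc k)))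
    (cong₂ _-_ (sym (length-filter (λ j → n ℕ./ suc j) id n))
      (trans (∑-swap n J (λ k j → χ (suc (j ℕ.* 2)) (n ℕ./ suc k) - χ (suc (suc (j ℕ.* 2))) (n ℕ./ suc k)))
        (∑-cong J λ j → trans
          (∑-distrib-- n (λ k → χ (suc (j ℕ.* 2)) (n ℕ./ suc k)) (λ k → χ (suc (suc (j ℕ.* 2))) (n ℕ./ suc k)))
          (cong₂ _-_ (∑χ-/ n (suc (j ℕ.* 2))) (∑χ-/ n (suc (suc (j ℕ.* 2))))))))

  -- The errors of `parity-error` are all nonnegative, and their upper bounds sum to a single floor.
  ∣𝓕-altFloors∣ : ∀ n J → ∣ ι (𝓕 n) - altFloors n J ∣ ≤ ι (n ℕ./ suc (J ℕ.* 2))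
  ∣𝓕-altFloors∣ n J = begin
    ∣ ι (𝓕 n) - altFloors n J ∣                                   ≡⟨ ℚₚ.0≤p⇒∣p∣≡p lower ⟩
    ι (𝓕 n) - altFloors n J                                       ≡⟨ 𝓕-altFloors n J ⟨
    ∑[ n ] (λ k → ι ((n ℕ./ suc k) ℕ.% 2) - parity J (n ℕ./ suc k))
      ≤⟨ ∑-mono-≤ n (λ k → proj₂ (parity-error J (n ℕ./ suc k))) ⟩
    ∑[ n ] (λ k → χ (suc (J ℕ.* 2)) (n ℕ./ suc k))                ≡⟨ ∑χ-/ n (suc (J ℕ.* 2)) ⟩
    ι (n ℕ./ suc (J ℕ.* 2))                                       ∎
    where
    open ℚₚ.≤-Reasoning
    lower : 0ℚ ≤ ι (𝓕 n) - altFloors n J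
    lower = subst₂ _≤_ (∑-zero n) (𝓕-altFloors n J) (∑-mono-≤ n (λ k → proj₁ (parity-error J (n ℕ./ suc k))))

  -- From floors to the alternating harmonic sum

  -- With q the quotient, this is q(d+1) ≤ n ≤ (q+1)(d+1) divided by d+1.
  floor-error : ∀ n d → 0ℚ ≤ ι n * 1/[1+ d ] - ι (n ℕ./ suc d) × ι n * 1/[1+ d ] - ι (n ℕ./ suc d) ≤ 1ℚ
  floor-error n d = lower , upper
    where
    open ℚₚ.≤-Reasoning
    r = 1/[1+ d ]
    q = n ℕ./ suc d
    lower : 0ℚ ≤ ι n * r - ι q
    lower = ≤⇒0≤- (begin
      ι q                      ≡⟨ ℚₚ.*-identityʳ (ι q) ⟨
      ι q * 1ℚ                 ≡⟨ cong (ι q *_) (n*1/n (suc d)) ⟨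
      ι q * (ι (suc d) * r)    ≡⟨ ℚₚ.*-assoc (ι q) (ι (suc d)) r ⟨
      ι q * ι (suc d) * r      ≡⟨ cong (_* r) (ι-* q (suc d)) ⟨
      ι (q ℕ.* suc d) * r      ≤⟨ *-mono-≤ʳ r (0≤1/n (suc d)) (ι-mono-≤ (ℕₚ.m/n*n≤m n (suc d))) ⟩
      ι n * r                  ∎)
    n≤ : n ℕ.≤ suc q ℕ.* suc d
    n≤ = ℕₚ.<⇒≤ (ℕₚ.≰⇒> (λ le → ℕₚ.<-irrefl refl (*≤⇒≤/ (suc q) (suc d) le)))
    upper : ι n * r - ι q ≤ 1ℚ
    upper = begin
      ι n * r - ι q                       ≤⟨ ℚₚ.+-monoˡ-≤ (- ι q) (*-mono-≤ʳ r (0≤1/n (suc d)) (ι-mono-≤ n≤)) ⟩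
      ι (suc q ℕ.* suc d) * r - ι q       ≡⟨ cong (λ z → z * r - ι q) (ι-* (suc q) (suc d)) ⟩
      ι (suc q) * ι (suc d) * r - ι q     ≡⟨ cong (_- ι q) (ℚₚ.*-assoc (ι (suc q)) (ι (suc d)) r) ⟩
      ι (suc q) * (ι (suc d) * r) - ι q   ≡⟨ cong₂ (λ y z → y * z - ι q) (ι-+ 1 q) (n*1/n (suc d)) ⟩
      (1ℚ + ι q) * 1ℚ - ι q               ≡⟨ solve 1 (λ q → (con 1ℚ :+ q) :* con 1ℚ :- q := con 1ℚ) refl (ι q) ⟩
      1ℚ                                  ∎

  altHarmonic : ℕ → ℚ
  altHarmonic J = ∑[ J ] (λ j → 1/[1+ j ℕ.* 2 ] - 1/[1+ suc (j ℕ.* 2) ])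

  -- Each summand is regrouped as the rounding error at 2j+2 minus the one at 2j+1. Both lie in
  -- [0, 1], so their difference costs at most 1, not 2.
  ∣altFloors-altHarmonic∣ : ∀ n J → ∣ altFloors n J - ι n * altHarmonic J ∣ ≤ ι J
  ∣altFloors-altHarmonic∣ n J = subst (λ z → ∣ z ∣ ≤ ι J)
    (trans
      (∑-cong J λ j → solve 5 (λ n u v p q → (n :* v :- q) :- (n :* u :- p) := (p :- q) :- n :* (u :- v)) refl
        (ι n) 1/[1+ j ℕ.* 2 ] 1/[1+ suc (j ℕ.* 2) ] (ι (n ℕ./ suc (j ℕ.* 2))) (ι (n ℕ./ suc (suc (j ℕ.* 2)))))
      (trans
        (∑-distrib-- J (λ j → ι (n ℕ./ suc (j ℕ.* 2)) - ι (n ℕ./ suc (suc (j ℕ.* 2))))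
                       (λ j → ι n * (1/[1+ j ℕ.* 2 ] - 1/[1+ suc (j ℕ.* 2) ])))
        (cong (λ z → altFloors n J - z)
          (sym (*-distribˡ-∑ J (ι n) (λ j → 1/[1+ j ℕ.* 2 ] - 1/[1+ suc (j ℕ.* 2) ]))))))
    (∣∑∣≤n J _ λ j → ∣p-q∣≤r
      (proj₁ (floor-error n (suc (j ℕ.* 2)))) (proj₂ (floor-error n (suc (j ℕ.* 2))))
      (proj₁ (floor-error n (j ℕ.* 2)))       (proj₂ (floor-error n (j ℕ.* 2))))

  -- The Riemann sums of log 2

  module Log2 where

    lip = Recip-Lipschitz.lipschitz 2ℚ 0<2
    open Riemann-Cauchy 1ℚ 2ℚ recip lip public using (∑-split; rate)
    open Recip-Lipschitz 2ℚ 0<2 public using (recip-inverse)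

  open Log2

  -- `S m` unfolds to the Riemann sum of 1/t over [1, 2] with m + 1 subintervals, so `rate` bounds
  -- the distance between any two of its terms.
  S : ℕ → ℚ
  S = seq (log 2ℚ)

  halve : ∀ j → 1/[1+ suc (j ℕ.* 2) ] + 1/[1+ suc (j ℕ.* 2) ] ≡ 1/[1+ j ]
  halve j = trans (cong (λ z → z + z) (1/-* (suc j) 2)) (halves 1/[1+ j ])

  -- Write u - v = (u + v) - 2v, where 2v = 1/(j+1) by `halve`. The sum becomes the harmonic number
  -- of 2J minus that of J.
  altHarmonic-tail : ∀ J → altHarmonic J ≡ ∑[ J ] (λ i → 1/[1+ J ℕ.+ i ])
  altHarmonic-tail J = begin
    altHarmonic J
      ≡⟨ ∑-cong J (λ j → trans
           (solve 2 (λ u v → u :- v := (u :+ v) :- (v :+ v)) refl 1/[1+ j ℕ.* 2 ] 1/[1+ suc (j ℕ.* 2) ])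
           (cong (λ z → 1/[1+ j ℕ.* 2 ] + 1/[1+ suc (j ℕ.* 2) ] - z) (halve j))) ⟩
    ∑[ J ] (λ j → 1/[1+ j ℕ.* 2 ] + 1/[1+ suc (j ℕ.* 2) ] - 1/[1+ j ])
      ≡⟨ ∑-distrib-- J (λ j → 1/[1+ j ℕ.* 2 ] + 1/[1+ suc (j ℕ.* 2) ]) 1/[1+_] ⟩
    ∑[ J ] (λ j → 1/[1+ j ℕ.* 2 ] + 1/[1+ suc (j ℕ.* 2) ]) - H
      ≡⟨ cong (_- H) (∑-pairs J 1/[1+_]) ⟨
    ∑[ J ℕ.* 2 ] 1/[1+_] - H
      ≡⟨ cong (λ z → ∑[ z ] 1/[1+_] - H) (trans (ℕₚ.*-comm J 2) (cong (J ℕ.+_) (ℕₚ.+-identityʳ J))) ⟩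
    ∑[ J ℕ.+ J ] 1/[1+_] - H
      ≡⟨ cong (_- H) (∑-split J J 1/[1+_]) ⟩
    H + T - H
      ≡⟨ solve 2 (λ h t → h :+ t :- h := t) refl H T ⟩
    T ∎
    where
    open ≡-Reasoning
    H = ∑[ J ] 1/[1+_]
    T = ∑[ J ] (λ i → 1/[1+ J ℕ.+ i ])

  recip-unique : ∀ {t y} → 0ℚ < t → t * y ≡ 1ℚ → recip t ≡ y
  recip-unique {t} {y} 0<t ty≡1 = begin
    recip t              ≡⟨ ℚₚ.*-identityʳ (recip t) ⟨
    recip t * 1ℚ         ≡⟨ cong (recip t *_) ty≡1 ⟨
    recip t * (t * y)    ≡⟨ solve 3 (λ i t y → i :* (t :* y) := (t :* i) :* y) refl (recip t) t y ⟩
    (t * recip t) * y    ≡⟨ cong (_* y) (recip-inverse t 0<t) ⟩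
    1ℚ * y               ≡⟨ ℚₚ.*-identityˡ y ⟩
    y                    ∎
    where open ≡-Reasoning

  -- The node is 1 + i/(m+1) = (m+1+i)/(m+1); the length 2 - 1 of the interval computes to `1ℚ`.
  recip-node : ∀ m i → recip (node 1ℚ 2ℚ (suc m) i) ≡ ι (suc m) * 1/[1+ m ℕ.+ i ]
  recip-node m i = recip-unique
    (ℚₚ.+-mono-<-≤ (ℚₚ.positive⁻¹ 1ℚ) (*-nonNeg (0≤k/n i (suc m)) (0≤ι 1))) (begin
    (1ℚ + (+ i / suc m) * 1ℚ) * (ι (suc m) * u)    ≡⟨ cong (λ z → (1ℚ + z * 1ℚ) * (ι (suc m) * u)) (/-≡ i (suc m)) ⟩
    (1ℚ + ι i * r * 1ℚ) * (ι (suc m) * u)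
      ≡⟨ solve 4 (λ i r n u → (con 1ℚ :+ i :* r :* con 1ℚ) :* (n :* u) := (n :+ i :* (n :* r)) :* u) refl (ι i) r (ι (suc m)) u ⟩
    (ι (suc m) + ι i * (ι (suc m) * r)) * u        ≡⟨ cong (λ z → (ι (suc m) + ι i * z) * u) (n*1/n (suc m)) ⟩
    (ι (suc m) + ι i * 1ℚ) * u                     ≡⟨ cong (λ z → (ι (suc m) + z) * u) (ℚₚ.*-identityʳ (ι i)) ⟩
    (ι (suc m) + ι i) * u                          ≡⟨ cong (_* u) (ι-+ (suc m) i) ⟨
    ι (suc (m ℕ.+ i)) * u                          ≡⟨ n*1/n (suc (m ℕ.+ i)) ⟩
    1ℚ                                             ∎)
    where
    open ≡-Reasoning
    r = 1/[1+ m ]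
    u = 1/[1+ m ℕ.+ i ]

  -- The mesh 1/(m+1) cancels the numerator in `recip-node`. Left endpoints are used, so the sum
  -- runs from 1/(m+1) to 1/(2m+1).
  S-tail : ∀ m → S m ≡ ∑[ suc m ] (λ i → 1/[1+ m ℕ.+ i ])
  S-tail m = trans
    (*-distribˡ-∑ (suc m) (1ℚ * r) (λ i → recip (node 1ℚ 2ℚ (suc m) i)))
    (∑-cong (suc m) λ i → begin
      1ℚ * r * recip (node 1ℚ 2ℚ (suc m) i)          ≡⟨ cong (1ℚ * r *_) (recip-node m i) ⟩
      1ℚ * r * (ι (suc m) * 1/[1+ m ℕ.+ i ])
        ≡⟨ solve 3 (λ r n u → con 1ℚ :* r :* (n :* u) := (n :* r) :* u) refl r (ι (suc m)) 1/[1+ m ℕ.+ i ] ⟩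
      ι (suc m) * r * 1/[1+ m ℕ.+ i ]                ≡⟨ cong (_* 1/[1+ m ℕ.+ i ]) (n*1/n (suc m)) ⟩
      1ℚ * 1/[1+ m ℕ.+ i ]                           ≡⟨ ℚₚ.*-identityˡ 1/[1+ m ℕ.+ i ] ⟩
      1/[1+ m ℕ.+ i ]                                ∎)
    where
    open ≡-Reasoning
    r = 1/[1+ m ]

  ι*1/[1+]≤1 : ∀ {m n} → m ℕ.≤ suc n → ι m * 1/[1+ n ] ≤ 1ℚ
  ι*1/[1+]≤1 {m} {n} m≤ = subst (_≤ 1ℚ) (/-≡ m (suc n)) (k/n≤1 m (suc n) m≤)

  1/[1+]-antitone : ∀ {m n} → m ℕ.≤ n → 1/[1+ n ] ≤ 1/[1+ m ]
  1/[1+]-antitone {m} {n} m≤n = begin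
    v                      ≡⟨ ℚₚ.*-identityʳ v ⟨
    v * 1ℚ                 ≡⟨ cong (v *_) (n*1/n (suc m)) ⟨
    v * (ι (suc m) * u)    ≡⟨ solve 3 (λ v m u → v :* (m :* u) := (m :* v) :* u) refl v (ι (suc m)) u ⟩
    ι (suc m) * v * u      ≤⟨ *-mono-≤ʳ u (0≤1/n (suc m)) (ι*1/[1+]≤1 (ℕ.s≤s m≤n)) ⟩
    1ℚ * u                 ≡⟨ ℚₚ.*-identityˡ u ⟩
    u                      ∎
    where
    open ℚₚ.≤-Reasoning
    u = 1/[1+ m ]
    v = 1/[1+ n ]

  -- For J = m + 1, `S m` is 1/J + ... + 1/(2J-1), while the alternating sum is 1/(J+1) + ... +
  -- 1/(2J). The shift by one telescopes to 1/J - 1/(2J), both terms lying in [0, 1/J].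
  ∣altHarmonic-S∣ : ∀ m → ∣ altHarmonic (suc m) - S m ∣ ≤ 1/[1+ m ]
  ∣altHarmonic-S∣ m = begin
    ∣ altHarmonic J - S m ∣              ≡⟨ ∣p-q∣-sym (altHarmonic J) (S m) ⟩
    ∣ S m - altHarmonic J ∣              ≡⟨ cong₂ (λ y z → ∣ y - z ∣) (S-tail m) (trans (altHarmonic-tail J)
                                              (∑-cong J λ i → cong 1/[1+_] (sym (ℕₚ.+-suc m i)))) ⟩
    ∣ ∑[ J ] f - ∑[ J ] (λ i → f (suc i)) ∣    ≡⟨ cong ∣_∣ (∑-distrib-- J f (λ i → f (suc i))) ⟨
    ∣ ∑[ J ] (λ i → f i - f (suc i)) ∣   ≡⟨ cong ∣_∣ (∑-telescope J f) ⟩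
    ∣ f 0 - f J ∣                        ≤⟨ ∣p-q∣≤r (0≤1/n (suc (m ℕ.+ 0))) (1/[1+]-antitone (ℕₚ.m≤m+n m 0))
                                                    (0≤1/n (suc (m ℕ.+ J))) (1/[1+]-antitone (ℕₚ.m≤m+n m J)) ⟩
    1/[1+ m ]                            ∎
    where
    open ℚₚ.≤-Reasoning
    J = suc m
    f = λ i → 1/[1+ m ℕ.+ i ]

  -- The error bound

  d = 2ℚ - 1ℚ

  -- The constant of Riemann-Cauchy.rate.
  C : ℚ
  C = LipschitzOn.constant lip * ∣ d ∣ * ∣ d ∣

  0≤C : 0ℚ ≤ C
  0≤C = *-nonNeg (*-nonNeg (LipschitzOn.0≤constant lip) (ℚₚ.0≤∣p∣ d)) (ℚₚ.0≤∣p∣ d)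

  4ℚ 9ℚ : ℚ
  4ℚ = ι 4
  9ℚ = ι 9

  -- Collects the errors in units of J = ⌊√n⌋. The 9 is 4 + 1 + 4: truncating the parity, dropping
  -- the floors, and passing to the Riemann sum. The terms 4C and C come from the two halves of
  -- `rate`.
  B : ℚ
  B = 9ℚ + (4ℚ * C + C)

  0≤B : 0ℚ ≤ B
  0≤B = ℚₚ.+-mono-≤ (0≤ι 9) (ℚₚ.+-mono-≤ (*-nonNeg (0≤ι 4) 0≤C) 0≤C)

  -- Since J = ⌊√n⌋ ≥ 1, n < (J+1)² ≤ (2J)².
  n≤4J² : ∀ n m → isqrt n ≡ suc m → n ℕ.≤ 4 ℕ.* suc m ℕ.* suc m
  n≤4J² n m eq = begin
    n                                      ≤⟨ ℕₚ.<⇒≤ (isqrt-upper n) ⟩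
    suc (isqrt n) ℕ.* suc (isqrt n)        ≡⟨ cong (λ z → suc z ℕ.* suc z) eq ⟩
    suc J ℕ.* suc J                        ≤⟨ ℕₚ.*-mono-≤ 1+J≤2J 1+J≤2J ⟩
    (J ℕ.+ J) ℕ.* (J ℕ.+ J)                ≡⟨ solveℕ 1 (λ j → ((j ⊕ j) ⊗ (j ⊕ j)) ⊜ ((conℕ 4 ⊗ j) ⊗ j)) refl J ⟩
    4 ℕ.* J ℕ.* J                          ∎
    where
    open ℕₚ.≤-Reasoning
    open ℕ-Solver.+-*-Solver using () renaming (solve to solveℕ; _:+_ to _⊕_; _:*_ to _⊗_; _:=_ to _⊜_; con to conℕ)
    J = suc m
    1+J≤2J : suc J ℕ.≤ J ℕ.+ J
    1+J≤2J = ℕₚ.+-monoˡ-≤ J (ℕ.s≤s ℕ.z≤n)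

  n/J≤4J : ∀ n m → isqrt n ≡ suc m → ι n * 1/[1+ m ] ≤ 4ℚ * ι (suc m)
  n/J≤4J n m eq = begin
    ι n * r                      ≤⟨ *-mono-≤ʳ r (0≤1/n J) (ι-mono-≤ (n≤4J² n m eq)) ⟩
    ι (4 ℕ.* J ℕ.* J) * r        ≡⟨ cong (_* r) (ι-* (4 ℕ.* J) J) ⟩
    ι (4 ℕ.* J) * ι J * r        ≡⟨ ℚₚ.*-assoc (ι (4 ℕ.* J)) (ι J) r ⟩
    ι (4 ℕ.* J) * (ι J * r)      ≡⟨ cong₂ _*_ (ι-* 4 J) (n*1/n J) ⟩
    4ℚ * ι J * 1ℚ                ≡⟨ ℚₚ.*-identityʳ (4ℚ * ι J) ⟩
    4ℚ * ι J                     ∎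
    where
    open ℚₚ.≤-Reasoning
    J = suc m
    r = 1/[1+ m ]

  isqrt-pos : ∀ n .{{_ : NonZero n}} → ∃[ m ] isqrt n ≡ suc m
  isqrt-pos n@(suc _) with isqrt n | isqrt-upper n
  ... | zero  | ℕ.s≤s ()
  ... | suc m | _ = m , refl

  -- An inequality in ℝ concerns all late terms of the sequences, so the bound must be uniform in
  -- the index k of the approximation to log 2. Taking n ≤ k + 1 makes the contribution nC/(k+1) of
  -- that index at most C.
  error-J : ∀ n m k → isqrt n ≡ suc m → n ℕ.≤ suc k → ∣ ι (𝓕 n) - ι n * S k ∣ ≤ B * ι (suc m)
  error-J n m k eq n≤k = begin
    ∣ ι (𝓕 n) - ι n * S k ∣
      -- The chain runs from 𝓕 n through the sum of floors, n times the alternating sum, and n ·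
      -- `S m` (J subintervals) to n · `S k`.
      ≡⟨ cong ∣_∣ (solve 6 (λ f q n a s t → f :- n :* t := (f :- q) :+ ((q :- n :* a) :+ (n :* (a :- s) :+ n :* (s :- t)))) refl
           (ι (𝓕 n)) Q (ι n) A (S m) (S k)) ⟩
    ∣ (ι (𝓕 n) - Q) + ((Q - ι n * A) + (ι n * (A - S m) + ι n * (S m - S k))) ∣
      ≤⟨ add-bounds (ℚₚ.≤-trans (∣𝓕-altFloors∣ n J) floor≤)
           (add-bounds (∣altFloors-altHarmonic∣ n J)
             (add-bounds (ℚₚ.≤-trans (scaled (∣altHarmonic-S∣ m)) X≤) scaled-rate)) ⟩
    4ℚ * j + (j + (4ℚ * j + (4ℚ * C * j + C * j)))
      ≡⟨ solve 2 (λ j c → con 4ℚ :* j :+ (j :+ (con 4ℚ :* j :+ (con 4ℚ :* c :* j :+ c :* j)))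
            := (con 9ℚ :+ (con 4ℚ :* c :+ c)) :* j) refl j C ⟩
    B * j ∎
    where
    open ℚₚ.≤-Reasoning
    open Riemann-Cauchy 1ℚ 2ℚ recip lip using (add-bounds)
    J = suc m
    j = ι J
    Q = altFloors n J
    A = altHarmonic J
    r = 1/[1+ m ]
    X≤ : ι n * r ≤ 4ℚ * j
    X≤ = n/J≤4J n m eq
    Y≤ : ι n * 1/[1+ k ] ≤ j
    Y≤ = ℚₚ.≤-trans (ι*1/[1+]≤1 n≤k) (ι-mono-≤ {1} {J} (ℕ.s≤s ℕ.z≤n))
    floor≤ : ι (n ℕ./ suc (J ℕ.* 2)) ≤ 4ℚ * j
    floor≤ = begin
      -- Replacing 2J + 1 by J is crude, but it lets the bound n/J ≤ 4J serve here as well.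
      ι (n ℕ./ suc (J ℕ.* 2))    ≤⟨ ι-mono-≤ (ℕₚ./-monoʳ-≤ n (ℕₚ.m≤n⇒m≤1+n (ℕₚ.m≤m*n J 2))) ⟩
      ι (n ℕ./ J)                ≤⟨ 0≤-⇒≤ (proj₁ (floor-error n m)) ⟩
      ι n * r                    ≤⟨ X≤ ⟩
      4ℚ * j                     ∎
    scaled : ∀ {p c} → ∣ p ∣ ≤ c → ∣ ι n * p ∣ ≤ ι n * c
    scaled {p} {c} p≤c = subst (_≤ ι n * c)
      (sym (trans (ℚₚ.∣p*q∣≡∣p∣*∣q∣ (ι n) p) (cong (_* ∣ p ∣) (ℚₚ.0≤p⇒∣p∣≡p (0≤ι n)))))
      (*-mono-≤ˡ (ι n) (0≤ι n) p≤c)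
    scaled-rate : ∣ ι n * (S m - S k) ∣ ≤ 4ℚ * C * j + C * j
    scaled-rate = begin
      ∣ ι n * (S m - S k) ∣                   ≤⟨ scaled (rate m k) ⟩
      ι n * (C * r + C * 1/[1+ k ])           ≡⟨ solve 4 (λ n c r s → n :* (c :* r :+ c :* s) := c :* (n :* r) :+ c :* (n :* s)) refl (ι n) C r 1/[1+ k ] ⟩
      C * (ι n * r) + C * (ι n * 1/[1+ k ])   ≤⟨ ℚₚ.+-mono-≤ (*-mono-≤ˡ C 0≤C X≤) (*-mono-≤ˡ C 0≤C Y≤) ⟩
      C * (4ℚ * j) + C * j                    ≡⟨ cong (_+ C * j) (solve 2 (λ c j → c :* (con 4ℚ :* j) := con 4ℚ :* c :* j) refl C j) ⟩
      4ℚ * C * j + C * j                      ∎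

  error : ∀ n .{{_ : NonZero n}} k → n ℕ.≤ k → ∣ ι (𝓕 n) - ι n * S k ∣ ≤ B * ι (isqrt n)
  error n k n≤k = let m , eq = isqrt-pos n in
    subst (λ z → ∣ ι (𝓕 n) - ι n * S k ∣ ≤ B * ι z) (sym eq) (error-J n m k eq (ℕₚ.m≤n⇒m≤1+n n≤k))

  -- Comparison with √n, and the ratio 𝓕 n / n.

  m²≤n⇒m≤isqrt : ∀ m {n} → m ℕ.* m ℕ.≤ n → m ℕ.≤ isqrt n
  m²≤n⇒m≤isqrt m {n} m²≤n = ℕₚ.≮⇒≥ λ lt → ℕₚ.<-irrefl refl
    (ℕₚ.<-≤-trans (isqrt-upper n) (ℕₚ.≤-trans (ℕₚ.*-mono-≤ lt lt) m²≤n))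

  -- With a = ⌊√n⌋ and p = k + 1, (ap)² ≤ np², so rounding √n down to a multiple of 1/p never falls
  -- below a. The bound by ⌊√n⌋ thus passes to every term of the sequence for √n.
  isqrt≤√-seq : ∀ n k → ι (isqrt n) ≤ √-seq n k
  isqrt≤√-seq n k = begin
    ι a                              ≡⟨ ℚₚ.*-identityʳ (ι a) ⟨
    ι a * 1ℚ                         ≡⟨ cong (ι a *_) (n*1/n p) ⟨
    ι a * (ι p * r)                  ≡⟨ ℚₚ.*-assoc (ι a) (ι p) r ⟨
    ι a * ι p * r                    ≡⟨ cong (_* r) (ι-* a p) ⟨
    ι (a ℕ.* p) * r                  ≤⟨ *-mono-≤ʳ r (0≤1/n p) (ι-mono-≤ (m²≤n⇒m≤isqrt (a ℕ.* p) le)) ⟩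
    ι (isqrt (n ℕ.* (p ℕ.* p))) * r  ≡⟨ /-≡ (isqrt (n ℕ.* (p ℕ.* p))) p ⟨
    √-seq n k                        ∎
    where
    open ℚₚ.≤-Reasoning
    a = isqrt n
    p = suc k
    r = 1/[1+ k ]
    le : (a ℕ.* p) ℕ.* (a ℕ.* p) ℕ.≤ n ℕ.* (p ℕ.* p)
    le = subst (ℕ._≤ n ℕ.* (p ℕ.* p)) (ℕₚ.[m*n]*[o*p]≡[m*o]*[n*p] a a p p) (ℕₚ.*-monoˡ-≤ (p ℕ.* p) (isqrt-lower n))

  error-√ : ∀ n .{{_ : NonZero n}} k → n ℕ.≤ k → ∣ ι (𝓕 n) - ι n * S k ∣ ≤ B * √-seq n k
  error-√ n k n≤k = ℚₚ.≤-trans (error n k n≤k) (*-mono-≤ˡ B 0≤B (isqrt≤√-seq n k))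

  -- Past R², where R exceeds B / η, the relative error B ⌊√n⌋ / n is at most η.
  error-ratio : ∀ η → 0ℚ < η → ∃[ N ] ∀ n .{{_ : NonZero n}} → N ℕ.≤ n →
                ∀ k → n ℕ.≤ k → ∣ (+ 1 / n) * ι (𝓕 n) - S k ∣ ≤ η
  error-ratio η 0<η = R ℕ.* R , λ n R²≤n k n≤k → let r = + 1 / n ; J = isqrt n in begin
    ∣ r * ι (𝓕 n) - S k ∣              ≡⟨ cong (λ z → ∣ r * ι (𝓕 n) - z ∣) (ℚₚ.*-identityˡ (S k)) ⟨
    ∣ r * ι (𝓕 n) - 1ℚ * S k ∣         ≡⟨ cong (λ z → ∣ r * ι (𝓕 n) - z * S k ∣) (n*1/n n) ⟨
    ∣ r * ι (𝓕 n) - ι n * r * S k ∣    ≡⟨ cong ∣_∣ (solve 4 (λ r f n s → r :* f :- n :* r :* s := r :* (f :- n :* s)) refl r (ι (𝓕 n)) (ι n) (S k)) ⟩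
    ∣ r * (ι (𝓕 n) - ι n * S k) ∣      ≡⟨ ℚₚ.∣p*q∣≡∣p∣*∣q∣ r (ι (𝓕 n) - ι n * S k) ⟩
    ∣ r ∣ * ∣ ι (𝓕 n) - ι n * S k ∣    ≡⟨ cong (_* ∣ ι (𝓕 n) - ι n * S k ∣) (ℚₚ.0≤p⇒∣p∣≡p (0≤1/n n)) ⟩
    r * ∣ ι (𝓕 n) - ι n * S k ∣        ≤⟨ *-mono-≤ˡ r (0≤1/n n) (error n k n≤k) ⟩
    r * (B * ι J)                      ≤⟨ *-mono-≤ˡ r (0≤1/n n) (*-mono-≤ʳ (ι J) (0≤ι J) (B≤ (m²≤n⇒m≤isqrt R R²≤n))) ⟩
    r * (η * ι J * ι J)                ≡⟨ cong (r *_) (trans (ℚₚ.*-assoc η (ι J) (ι J)) (cong (η *_) (sym (ι-* J J)))) ⟩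
    r * (η * ι (J ℕ.* J))              ≤⟨ *-mono-≤ˡ r (0≤1/n n) (*-mono-≤ˡ η (ℚₚ.<⇒≤ 0<η) (ι-mono-≤ (isqrt-lower n))) ⟩
    r * (η * ι n)                      ≡⟨ solve 3 (λ r e n → r :* (e :* n) := e :* (n :* r)) refl r η (ι n) ⟩
    η * (ι n * r)                      ≡⟨ cong (η *_) (n*1/n n) ⟩
    η * 1ℚ                             ≡⟨ ℚₚ.*-identityʳ η ⟩
    η                                  ∎
    where
    open ℚₚ.≤-Reasoning
    η≢0 = >-nonZero 0<η
    i = (1/ η) {{η≢0}}
    R = proj₁ (archimedean (B * i))
    B≤ : ∀ {J} → R ℕ.≤ J → B ≤ η * ι J
    B≤ {J} R≤J = begin
      B              ≡⟨ ℚₚ.*-identityʳ B ⟨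
      B * 1ℚ         ≡⟨ cong (B *_) (ℚₚ.*-inverseʳ η {{η≢0}}) ⟨
      B * (η * i)    ≡⟨ solve 3 (λ b e i → b :* (e :* i) := e :* (b :* i)) refl B η i ⟩
      η * (B * i)    ≤⟨ *-mono-≤ˡ η (ℚₚ.<⇒≤ 0<η) (ℚₚ.≤-trans (ℚₚ.<⇒≤ (proj₂ (archimedean (B * i)))) (ι-mono-≤ R≤J)) ⟩
      η * ι J        ∎

  p≤p+ε : ∀ {p q ε} → p ≤ q → 0ℚ < ε → p ≤ q + ε
  p≤p+ε {p} {q} p≤q 0<ε = ℚₚ.≤-trans p≤q (subst (_≤ q + _) (ℚₚ.+-identityʳ q) (ℚₚ.+-monoʳ-≤ q (ℚₚ.<⇒≤ 0<ε)))

  -- Splits a rational gap below q in two: one half absorbs the error p, the other remains as the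
  -- margin for strict inequality in ℝ. The form `0ℚ + ε` is that of an unfolded `fromℕ 0 < ε`.
  p+½ε≤q : ∀ {p q} ε → p ≤ ε * ½ → 0ℚ + ε ≤ q → p + ε * ½ ≤ q
  p+½ε≤q ε p≤½ε ε≤q = ℚₚ.≤-trans
    (ℚₚ.≤-trans (ℚₚ.+-monoˡ-≤ (ε * ½) p≤½ε) (ℚₚ.≤-reflexive (trans (halves ε) (sym (ℚₚ.+-identityˡ ε))))) ε≤q

-- Passage to the reals.

open import Defs
open Rational using (B; error-√; error-ratio; p≤p+ε; p+½ε≤q)

proposition2p6 :
    ((λ n → fromℕ (𝓕 n) - fromℕ n * log (+ 2 / 1)) =O (λ n → √ n))
    × Limit (λ n → fromℚ (+ 1 / n) * fromℕ (𝓕 n)) (log (+ 2 / 1))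
proposition2p6 =
  -- The inequality of reals is witnessed termwise from index n on, where `error-√` applies.
  (fromℚ B , 0 , λ n _ ε 0<ε → n , λ k n≤k → p≤p+ε (error-√ n k n≤k) 0<ε) ,
  -- Positivity of the real ε supplies a rational δ > 0 below its terms from index K on. The error
  -- is made at most δ/2, and `K ⊔ n` secures both this bound and δ ≤ ε.
  λ { ε (δ , 0<δ , K , δ≤ε) →
        let 0<δ/2 = ℚ-Lemmas.*-pos 0<δ ℚ-Lemmas.0<½
            N , ratio≤ = error-ratio (δ ℚ.* ½) 0<δ/2
        in N , λ n N≤n → δ ℚ.* ½ , 0<δ/2 , K ℕ.⊔ n , λ k K⊔n≤k →
             p+½ε≤q δ (ratio≤ n N≤n k (ℕₚ.m⊔n≤o⇒n≤o K n K⊔n≤k)) (δ≤ε k (ℕₚ.m⊔n≤o⇒m≤o K n K⊔n≤k)) }
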